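{- Let $m\geqslant 2$ and $d\geqslant 2$ be integers, let $f(X)=a_dX^d+\ldots+a_1X+a_0\in\mathbb{Z}_m[X]$ be a polynomial of degree $d$ with $\gcd(a_d,m)=1$, and let $\mathcal{I}=\{1,\ldots,H\}$ with $1\leqslant H\leqslant m$, considered as a subset of $\mathbb{Z}_m$. Then for any set $\mathcal{Z}\subseteq\mathbb{Z}_m$ of cardinality $\#\mathcal{Z}=Z$ we have $$E(\mathcal{Z},f(\mathcal{I}))\leqslant\left(\frac{H^2Z^2}{m^{2/d(d+1)}}+Z(H+Z)\right)H^{o(1)}.$$
   Context: $\mathbb{Z}_m$ denotes the residue ring modulo $m$, and $f(\mathcal{I})=\{f(u):u\in\mathcal{I}\}\subseteq\mathbb{Z}_m$ is the image set (computed in $\mathbb{Z}_m$). For sets $\mathcal{A},\mathcal{B}\subseteq\mathbb{Z}_m$, $E(\mathcal{A},\mathcal{B})$ is the number of quadruples $(a_1,a_2,b_1,b_2)$ with $a_1,a_2\in\mathcal{A}$, $b_1,b_2\in\mathcal{B}$ and $a_1+b_1=a_2+b_2$ in $\mathbb{Z}_m$. The notation $H^{o(1)}$ denotes a factor which, for every fixed $\varepsilon>0$, is at most $C(d,\varepsilon)H^{\varepsilon}$, with $C(d,\varepsilon)$ depending only on $d$ and $\varepsilon$. -}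

module Defs where

open import Data.Nat using (ℕ; zero; suc; _+_; _*_; _^_; _%_; _≡ᵇ_; NonZero)
open import Data.Bool using (Bool; true; false; _∧_; _∨_; if_then_else_)
open import Data.Fin using (Fin; toℕ; fromℕ)
open import Data.Fin.Subset using (Subset)
open import Data.Vec using (lookup; tabulate)
open import Data.List using (List; map; foldr)
open import Data.Nat.ListAction using (sum)
open import Data.Integer using (+_)
open import Data.List using (allFin; upTo)
open import Data.Rational using (ℚ; 1ℚ; _/_) renaming (_*_ to _*ℚ_)

Σfin : ∀ {n} → (Fin n → ℕ) → ℕ
Σfin {n} g = sum (map g (allFin n))

ind : Bool → ℕ
ind b = if b then 1 else 0

-- a polynomial of degree d over Z_m is given by ℕ representatives a_0 … a_d
-- of its coefficients (a i is the coefficient of X^(toℕ i)); evaluation in ℕ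
evalPoly : ∀ {d} → (Fin (suc d) → ℕ) → ℕ → ℕ
evalPoly {d} a u = sum (map (λ i → a i * u ^ toℕ i) (allFin (suc d)))

imageSet : ∀ {d} (m : ℕ) .{{_ : NonZero m}} → (Fin (suc d) → ℕ) → ℕ → Subset m
imageSet m a H = tabulate (λ x →
  foldr _∨_ false (map (λ u → toℕ x ≡ᵇ (evalPoly a (suc u) % m)) (upTo H)))

energy : (m : ℕ) .{{_ : NonZero m}} → Subset m → Subset m → ℕ
energy m A B =
  Σfin {m} λ a₁ → Σfin {m} λ a₂ → Σfin {m} λ b₁ → Σfin {m} λ b₂ →
    ind (lookup A a₁ ∧ lookup A a₂ ∧ lookup B b₁ ∧ lookup B b₂ ∧
         (((toℕ a₁ + toℕ b₁) % m) ≡ᵇ ((toℕ a₂ + toℕ b₂) % m)))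

_^ℚ_ : ℚ → ℕ → ℚ
q ^ℚ zero = 1ℚ
q ^ℚ suc n = q *ℚ (q ^ℚ n)

ℕ→ℚ : ℕ → ℚ
ℕ→ℚ n = (+ n) / 1

{-# OPTIONS --safe #-}

-- Put d = deg f. If m is at most a constant times H^(d(d+1)/2), then t is at
-- least a constant times Z²H, and E ≤ Z²H holds trivially. For larger m, the
-- pigeonhole principle gives an integer vector c ≡ q (a₁, …, a_d) (mod m),
-- c_d ≠ 0, with |c_j| so small compared with m / H^j that c annihilates
-- (x^j - y^j - x′^j + y′^j)_j, not only mod m, whenever
-- f(x) - f(y) ≡ f(x′) - f(y′) (mod m). So for an integer polynomial F of
-- degree d the value F(x) - F(y) depends only on the class f(x) - f(y) mod m.
-- At most dH pairs have F(x) = F(y), and each of them extends to at most Z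
-- solutions of z₁ + f(x) ≡ z₂ + f(y). For given z₁, z₂ all other pairs share
-- one value n = F(x) - F(y) ≠ 0, so x - y divides n, and each difference x - y
-- is attained at most d - 1 times. After c is made polynomially bounded in H,
-- the divisor bound limits the number of these pairs by H^o(1).
module Submission where

open import Defs
open import Data.Nat using (ℕ; suc; _+_; _*_; _^_; _≤_; NonZero)
open import Data.Nat.GCD using (gcd)
open import Data.Fin using (Fin; fromℕ)
open import Data.Fin.Subset using (Subset; ∣_∣)
open import Data.Rational using (ℚ; 0ℚ) renaming (_≤_ to _≤ℚ_; _*_ to _*ℚ_; _+_ to _+ℚ_)
open import Data.Product using (∃-syntax)
open import Relation.Binary.PropositionalEquality using (_≡_)

open import Algebra.Bundles using (CommutativeMonoid)
open import Data.Bool using (Bool; true; false; _∧_; _∨_)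
open import Data.Fin as Fin using (zero; suc; toℕ; fromℕ<)
open import Data.Fin.Properties as Fin using (any?; toℕ-fromℕ<; toℕ-injective; toℕ<n; pigeonhole; combine-injective)
open import Data.Integer as ℤ using (ℤ; +_; 0ℤ; 1ℤ)
import Data.Integer.Properties as ℤ
open import Data.Integer.Divisibility.Signed using (divides; ∣⇒∣ᵤ; ∣ᵤ⇒∣; ∣m∣n⇒∣m+n; ∣m∣n⇒∣m-n; ∣m⇒∣m*n; ∣n⇒∣m*n; ∣m⇒∣-m; ∣m+n∣n⇒∣m) renaming (_∣_ to _∣ℤ_)
import Data.Integer.Tactic.RingSolver as ℤ-Solver
open import Data.List as List using ([]; _∷_; allFin; map)
open import Data.List.Properties using (map-tabulate)
open import Data.List.Relation.Unary.All using (All; []; _∷_)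
open import Data.Nat using (zero; _∸_; _<_; z≤n; s≤s; pred; _%_; _/_; _≡ᵇ_; NonTrivial; >-nonZero; >-nonZero⁻¹; ≢-nonZero; ≢-nonZero⁻¹; n>1⇒nonTrivial)
open import Data.Nat.Coprimality as Coprimality using (Coprime; coprime-divisor; GCD≡1⇒coprime; gcd≡1⇒coprime)
open import Data.Nat.DivMod using (m≡m%n+[m/n]*n; m%n<n; m<n*o⇒m/o<n)
open import Data.Nat.Divisibility using (_∣?_; divides; _∣0; ∣⇒≤; ∣1⇒≡1; ∣-trans; m∣m*n; n∣m*n; *-cancelˡ-∣) renaming (_∣_ to _∣ℕ_)
open import Data.Nat.GCD using (gcd[m,n]∣m; gcd[m,n]∣n; gcd[m,n]≢0; GCD; gcd-GCD; GCD-*)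
open import Data.Nat.Induction using (<-rec)
open import Data.Nat.ListAction as ListAction using (product)
open import Data.Nat.Primality using (Prime; _Rough_; euclidsLemma; rough∧∣⇒prime; rough∧∣⇒rough; ∤⇒rough-suc; 2-rough; prime⇒nonZero; prime⇒nonTrivial)
open import Data.Nat.Primality.Factorisation using (factorise; PrimeFactorisation)
open import Data.Nat.Properties
import Data.Nat.Tactic.RingSolver as ℕ-Solver
open import Data.Product using (_×_; _,_; proj₁; proj₂; ∃)
open import Data.Rational as ℚ using (1ℚ; nonNegative; positive; toℚᵘ) renaming (_<_ to _<ℚ_)
import Data.Rational.Properties as ℚ
open import Data.Rational.Unnormalised as ℚᵘ using (mkℚᵘ; _≃_; *≡*; *≤*)
import Data.Rational.Unnormalised.Properties as ℚᵘ
open import Data.Sum using (_⊎_; inj₁; inj₂)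
open import Data.Vec using (lookup; []; _∷_)
open import Data.Vec.Properties using (lookup∘tabulate)
import Data.Vec.Functional as Vector
open import Function using (_∘_; case_of_)
open import Relation.Binary.Definitions using (tri<; tri≈; tri>)
open import Relation.Binary.PropositionalEquality using (_≢_; refl; sym; trans; cong; cong₂; subst; module ≡-Reasoning)
open import Relation.Nullary using (Dec; yes; no; does; ¬_; contradiction; _×-dec_; map′)
open import Relation.Nullary.Decidable using (¬?)
open import Algebra.Properties.CommutativeSemigroup (CommutativeMonoid.commutativeSemigroup ℚ.*-1-commutativeMonoid) using (interchange)
open import Algebra.Properties.Semiring.Sum +-*-semiring using (sum; sum-syntax; sum-cong-≗; ∑-distrib-+; ∑-comm; *-distribˡ-sum; *-distribʳ-sum)

-- Sums of indicators

-- The exponent d(d+1)/2 is 1 + ... + d: coordinate j is cut into a constant multiple of H^j boxes,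
-- and the pigeonhole principle needs fewer boxes than the m multipliers q. The entries of the c
-- found in this way are only bounded by about m / H^j, so F(x) - F(y) may be of order m. As m is
-- not bounded by any power of H, the divisor bound would then cost m^o(1) instead of H^o(1). But
-- all that is used of c is c_d ≠ 0 and a set of linear equations indexed by quadruples in {1, ...,
-- H}⁴, with coefficients at most 2H^d. Once such a system has an integer solution with c_d ≠ 0, it
-- has one whose size is bounded in terms of d and H alone. The exact degree d enters twice: it
-- bounds the fibres of F, and, because d ≥ 2, it makes F(y + δ) - F(y) nonconstant in y for δ ≠ 0.
-- Real exponents are avoided: the divisor bound has the form τ(n)^M ≤ C n with a free integer M,
-- which is fixed once the exponent of H in the bound for F(x) - F(y) is known.

sum-mono : ∀ {n} {f g : Fin n → ℕ} → (∀ i → f i ≤ g i) → sum f ≤ sum g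
sum-mono {zero}  f≤g = z≤n
sum-mono {suc n} f≤g = +-mono-≤ (f≤g zero) (sum-mono (f≤g ∘ suc))

sum-bound : ∀ {n} {f : Fin n → ℕ} {c} → (∀ i → f i ≤ c) → sum f ≤ n * c
sum-bound {zero}  f≤c = z≤n
sum-bound {suc n} f≤c = +-mono-≤ (f≤c zero) (sum-bound (f≤c ∘ suc))

term≤sum : ∀ {n} (f : Fin n → ℕ) i → f i ≤ sum f
term≤sum f zero    = m≤m+n _ _
term≤sum f (suc i) = ≤-trans (term≤sum (f ∘ suc) i) (m≤n+m _ (f zero))

𝟙 : ∀ {P : Set} → Dec P → ℕ
𝟙 P? = ind (does P?)

𝟙≤ : ∀ {P : Set} (P? : Dec P) {x} → (P → 1 ≤ x) → 𝟙 P? ≤ x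
𝟙≤ (yes p) h = h p
𝟙≤ (no _)  h = z≤n

𝟙-yes : ∀ {P : Set} (P? : Dec P) → P → 1 ≤ 𝟙 P?
𝟙-yes (yes _) p = ≤-refl
𝟙-yes (no ¬p) p = contradiction p ¬p

𝟙-no : ∀ {P : Set} (P? : Dec P) → ¬ P → 𝟙 P? ≡ 0
𝟙-no (yes p) ¬p = contradiction p ¬p
𝟙-no (no _)  ¬p = refl

𝟙-mono : ∀ {P Q : Set} (P? : Dec P) (Q? : Dec Q) → (P → Q) → 𝟙 P? ≤ 𝟙 Q?
𝟙-mono P? Q? f = 𝟙≤ P? (𝟙-yes Q? ∘ f)

sum-𝟙-empty : ∀ {n} {P : Fin n → Set} (P? : ∀ i → Dec (P i)) → (∀ i → ¬ P i) → sum (𝟙 ∘ P?) ≡ 0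
sum-𝟙-empty {zero}  P? ¬P = refl
sum-𝟙-empty {suc n} P? ¬P = cong₂ _+_ (𝟙-no (P? zero) (¬P zero)) (sum-𝟙-empty (P? ∘ suc) (¬P ∘ suc))

sum-𝟙-unique : ∀ {n} {P : Fin n → Set} (P? : ∀ i → Dec (P i)) →
               (∀ {i j} → P i → P j → i ≡ j) → sum (𝟙 ∘ P?) ≤ 1
sum-𝟙-unique {zero}  P? unique = z≤n
sum-𝟙-unique {suc n} P? unique with P? zero
... | no _  = sum-𝟙-unique (P? ∘ suc) (λ p q → Fin.suc-injective (unique p q))
... | yes p = ≤-reflexive (cong suc (sum-𝟙-empty (P? ∘ suc) (λ i q → case unique p q of λ ())))

-- Polynomial functions

-- Poly n l g: the function g is given by a polynomial of formal degree n with
-- coefficient l at x^n, where l may be 0.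
data Poly : ℕ → ℤ → (ℤ → ℤ) → Set where
  const  : ∀ {l g} → (∀ x → g x ≡ l) → Poly 0 l g
  horner : ∀ {n l e g} c → Poly n l e → (∀ x → g x ≡ c ℤ.+ x ℤ.* e x) → Poly (suc n) l g

poly-≈ : ∀ {n l l′ g g′} → l ≡ l′ → (∀ x → g′ x ≡ g x) → Poly n l g → Poly n l′ g′
poly-≈ refl g≈ (const p)      = const (λ x → trans (g≈ x) (p x))
poly-≈ refl g≈ (horner c e p) = horner c e (λ x → trans (g≈ x) (p x))

poly-+ : ∀ {n l k g h} → Poly n l g → Poly n k h → Poly n (l ℤ.+ k) (λ x → g x ℤ.+ h x)
poly-+ (const p)      (const q)      = const (λ x → cong₂ ℤ._+_ (p x) (q x))
poly-+ (horner {e = e} a P p) (horner {e = f} b Q q) = horner (a ℤ.+ b) (poly-+ P Q)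
  (λ x → trans (cong₂ ℤ._+_ (p x) (q x)) (regroup a b x (e x) (f x)))
  where
  regroup : ∀ a b x e f → (a ℤ.+ x ℤ.* e) ℤ.+ (b ℤ.+ x ℤ.* f) ≡ (a ℤ.+ b) ℤ.+ x ℤ.* (e ℤ.+ f)
  regroup = ℤ-Solver.solve-∀

poly-scale : ∀ {n l g} r → Poly n l g → Poly n (r ℤ.* l) (λ x → r ℤ.* g x)
poly-scale r (const p)      = const (λ x → cong (r ℤ.*_) (p x))
poly-scale r (horner {e = e} c P p) = horner (r ℤ.* c) (poly-scale r P)
  (λ x → trans (cong (r ℤ.*_) (p x)) (regroup r c x (e x)))
  where
  regroup : ∀ r c x e → r ℤ.* (c ℤ.+ x ℤ.* e) ≡ r ℤ.* c ℤ.+ x ℤ.* (r ℤ.* e)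
  regroup = ℤ-Solver.solve-∀

-- Padding with a zero leading coefficient: `poly-+` adds only functions of equal formal degree, and
-- this lets a term of lower degree join without changing the leading coefficient.
poly-lift : ∀ {n l g} → Poly n l g → Poly (suc n) 0ℤ g
poly-lift {l = l} (const p) = horner l (const {g = λ _ → 0ℤ} (λ _ → refl)) (λ x → trans (p x) (regroup l x))
  where
  regroup : ∀ l x → l ≡ l ℤ.+ x ℤ.* 0ℤ
  regroup = ℤ-Solver.solve-∀
poly-lift (horner c P p) = horner c (poly-lift P) p

poly-x* : ∀ {n l g} → Poly n l g → Poly (suc n) l (λ x → x ℤ.* g x)
poly-x* P = horner 0ℤ P (λ x → sym (ℤ.+-identityˡ _))

-- For g = c + x e one has g(x) - g(r) = (x - r) e(x) + r (e(x) - e(r)), and recursion on e takes x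
-- - r out of the second term. That term contributes in lower degree only, so the quotient keeps the
-- leading coefficient l.
quotient : ∀ {n l g} → Poly (suc n) l g → ∀ r →
           ∃[ q ] (Poly n l q × (∀ x → g x ℤ.- g r ≡ (x ℤ.- r) ℤ.* q x))
quotient (horner {l = l} {g = g} c (const {g = e} k) p) r = e , const k , λ x → begin
  g x ℤ.- g r                                  ≡⟨ cong₂ ℤ._-_ (p x) (p r) ⟩
  (c ℤ.+ x ℤ.* e x) ℤ.- (c ℤ.+ r ℤ.* e r)      ≡⟨ cong₂ (λ u v → (c ℤ.+ x ℤ.* u) ℤ.- (c ℤ.+ r ℤ.* v)) (k x) (k r) ⟩
  (c ℤ.+ x ℤ.* l) ℤ.- (c ℤ.+ r ℤ.* l)          ≡⟨ regroup c x r l ⟩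
  (x ℤ.- r) ℤ.* l                              ≡⟨ cong ((x ℤ.- r) ℤ.*_) (k x) ⟨
  (x ℤ.- r) ℤ.* e x                            ∎
  where
  open ≡-Reasoning
  regroup : ∀ c x r l → (c ℤ.+ x ℤ.* l) ℤ.- (c ℤ.+ r ℤ.* l) ≡ (x ℤ.- r) ℤ.* l
  regroup = ℤ-Solver.solve-∀
quotient (horner {e = e} {g = g} c P@(horner {l = l} _ _ _) p) r with quotient P r
... | q , Q , e-quot = (λ x → e x ℤ.+ r ℤ.* q x)
    , poly-≈ (lead l r) (λ _ → refl) (poly-+ P (poly-scale r (poly-lift Q)))
    , λ x → begin
  g x ℤ.- g r                                                ≡⟨ cong₂ ℤ._-_ (p x) (p r) ⟩
  (c ℤ.+ x ℤ.* e x) ℤ.- (c ℤ.+ r ℤ.* e r)                    ≡⟨ regroup c x r (e x) (e r) ⟩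
  (x ℤ.- r) ℤ.* e x ℤ.+ r ℤ.* (e x ℤ.- e r)                  ≡⟨ cong (λ u → (x ℤ.- r) ℤ.* e x ℤ.+ r ℤ.* u) (e-quot x) ⟩
  (x ℤ.- r) ℤ.* e x ℤ.+ r ℤ.* ((x ℤ.- r) ℤ.* q x)            ≡⟨ collect x r (e x) (q x) ⟩
  (x ℤ.- r) ℤ.* (e x ℤ.+ r ℤ.* q x)                          ∎
  where
  open ≡-Reasoning
  lead : ∀ l r → l ℤ.+ r ℤ.* 0ℤ ≡ l
  lead = ℤ-Solver.solve-∀
  regroup : ∀ c x r e e′ → (c ℤ.+ x ℤ.* e) ℤ.- (c ℤ.+ r ℤ.* e′) ≡ (x ℤ.- r) ℤ.* e ℤ.+ r ℤ.* (e ℤ.- e′)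
  regroup = ℤ-Solver.solve-∀
  collect : ∀ x r e q → (x ℤ.- r) ℤ.* e ℤ.+ r ℤ.* ((x ℤ.- r) ℤ.* q) ≡ (x ℤ.- r) ℤ.* (e ℤ.+ r ℤ.* q)
  collect = ℤ-Solver.solve-∀

-- For g = c + x e one has g(y + δ) - g(y) = δ e(y) + (y + δ) (e(y + δ) - e(y)). Each Horner step
-- adds one more l to the leading coefficient, as in the derivative of l x^(n+1).
difference : ∀ {n l g} → Poly (suc n) l g → ∀ δ →
             ∃[ D ] (Poly n (+ suc n ℤ.* l) D × (∀ y → g (y ℤ.+ δ) ℤ.- g y ≡ δ ℤ.* D y))
difference (horner {l = l} {g = g} c (const {g = e} k) p) δ =
  e , const (λ x → trans (k x) (sym (ℤ.*-identityˡ l))) , λ y → begin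
  g (y ℤ.+ δ) ℤ.- g y                                        ≡⟨ cong₂ ℤ._-_ (p (y ℤ.+ δ)) (p y) ⟩
  (c ℤ.+ (y ℤ.+ δ) ℤ.* e (y ℤ.+ δ)) ℤ.- (c ℤ.+ y ℤ.* e y)    ≡⟨ cong₂ (λ u v → (c ℤ.+ (y ℤ.+ δ) ℤ.* u) ℤ.- (c ℤ.+ y ℤ.* v)) (k _) (k y) ⟩
  (c ℤ.+ (y ℤ.+ δ) ℤ.* l) ℤ.- (c ℤ.+ y ℤ.* l)                ≡⟨ regroup c y δ l ⟩
  δ ℤ.* l                                                    ≡⟨ cong (δ ℤ.*_) (k y) ⟨
  δ ℤ.* e y                                                  ∎
  where
  open ≡-Reasoning
  regroup : ∀ c y δ l → (c ℤ.+ (y ℤ.+ δ) ℤ.* l) ℤ.- (c ℤ.+ y ℤ.* l) ≡ δ ℤ.* l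
  regroup = ℤ-Solver.solve-∀
difference (horner {suc n} {l = l} {e = e} {g = g} c P p) δ with difference P δ
... | D , Q , e-diff = (λ y → e y ℤ.+ (y ℤ.* D y ℤ.+ δ ℤ.* D y))
    , poly-≈ lead (λ _ → refl) (poly-+ P (poly-+ (poly-x* Q) (poly-scale δ (poly-lift Q))))
    , λ y → begin
  g (y ℤ.+ δ) ℤ.- g y                                        ≡⟨ cong₂ ℤ._-_ (p (y ℤ.+ δ)) (p y) ⟩
  (c ℤ.+ (y ℤ.+ δ) ℤ.* e (y ℤ.+ δ)) ℤ.- (c ℤ.+ y ℤ.* e y)    ≡⟨ regroup c y δ (e (y ℤ.+ δ)) (e y) ⟩
  δ ℤ.* e y ℤ.+ (y ℤ.+ δ) ℤ.* (e (y ℤ.+ δ) ℤ.- e y)          ≡⟨ cong (λ u → δ ℤ.* e y ℤ.+ (y ℤ.+ δ) ℤ.* u) (e-diff y) ⟩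
  δ ℤ.* e y ℤ.+ (y ℤ.+ δ) ℤ.* (δ ℤ.* D y)                    ≡⟨ collect y δ (e y) (D y) ⟩
  δ ℤ.* (e y ℤ.+ (y ℤ.* D y ℤ.+ δ ℤ.* D y))                  ∎
  where
  open ≡-Reasoning
  lead′ : ∀ l δ N → l ℤ.+ (N ℤ.* l ℤ.+ δ ℤ.* 0ℤ) ≡ (+ 1 ℤ.+ N) ℤ.* l
  lead′ = ℤ-Solver.solve-∀
  lead : l ℤ.+ (+ suc n ℤ.* l ℤ.+ δ ℤ.* 0ℤ) ≡ + suc (suc n) ℤ.* l
  lead = lead′ l δ (+ suc n)
  regroup : ∀ c y δ e′ e → (c ℤ.+ (y ℤ.+ δ) ℤ.* e′) ℤ.- (c ℤ.+ y ℤ.* e) ≡ δ ℤ.* e ℤ.+ (y ℤ.+ δ) ℤ.* (e′ ℤ.- e)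
  regroup = ℤ-Solver.solve-∀
  collect : ∀ y δ e D → δ ℤ.* e ℤ.+ (y ℤ.+ δ) ℤ.* (δ ℤ.* D) ≡ δ ℤ.* (e ℤ.+ (y ℤ.* D ℤ.+ δ ℤ.* D))
  collect = ℤ-Solver.solve-∀

module _ {N} (v : Fin N → ℤ) (v-injective : ∀ {i j} → v i ≡ v j → i ≡ j) where

  -- If r is one point of the fibre, every other point is a root of the quotient of g(x) - g(r) by x
  -- - r, which has degree one less and the same leading coefficient; hence the mutual induction
  -- with `root-bound`.
  fibre-bound : ∀ {n l g} → Poly (suc n) l g → l ≢ 0ℤ → ∀ c →
                sum (λ i → 𝟙 (g (v i) ℤ.≟ c)) ≤ suc n
  root-bound : ∀ {n l g} → Poly n l g → l ≢ 0ℤ → sum (λ i → 𝟙 (g (v i) ℤ.≟ 0ℤ)) ≤ n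

  fibre-bound {g = g} P l≢0 c with any? (λ i → g (v i) ℤ.≟ c)
  ... | no none = ≤-trans (≤-reflexive (sum-𝟙-empty (λ i → g (v i) ℤ.≟ c) (λ i p → none (i , p)))) z≤n
  ... | yes (r , gr≡c) with quotient P (v r)
  ...   | q , Q , quot = begin
    sum (λ i → 𝟙 (g (v i) ℤ.≟ c))
      ≤⟨ sum-mono split ⟩
    sum (λ i → 𝟙 (i Fin.≟ r) + 𝟙 (q (v i) ℤ.≟ 0ℤ))
      ≡⟨ ∑-distrib-+ (λ i → 𝟙 (i Fin.≟ r)) _ ⟩
    sum (λ i → 𝟙 (i Fin.≟ r)) + sum (λ i → 𝟙 (q (v i) ℤ.≟ 0ℤ))
      ≤⟨ +-mono-≤ (sum-𝟙-unique (Fin._≟ r) (λ p q → trans p (sym q))) (root-bound Q l≢0) ⟩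
    suc _ ∎
    where
    open ≤-Reasoning
    split : ∀ i → 𝟙 (g (v i) ℤ.≟ c) ≤ 𝟙 (i Fin.≟ r) + 𝟙 (q (v i) ℤ.≟ 0ℤ)
    split i = 𝟙≤ (g (v i) ℤ.≟ c) λ gi≡c →
      case ℤ.i*j≡0⇒i≡0∨j≡0 (v i ℤ.- v r)
             (trans (sym (quot (v i))) (ℤ.i≡j⇒i-j≡0 (trans gi≡c (sym gr≡c)))) of λ where
        (inj₁ p) → ≤-trans (𝟙-yes (i Fin.≟ r) (v-injective (ℤ.i-j≡0⇒i≡j _ _ p))) (m≤m+n _ _)
        (inj₂ p) → ≤-trans (𝟙-yes (q (v i) ℤ.≟ 0ℤ) p) (m≤n+m _ _)

  root-bound {zero}  {g = g} (const k) l≢0 =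
    ≤-reflexive (sum-𝟙-empty (λ i → g (v i) ℤ.≟ 0ℤ) (λ i p → l≢0 (trans (sym (k (v i))) p)))
  root-bound {suc n} P l≢0 = fibre-bound P l≢0 0ℤ

-- The divisor bound

positive-index : ∀ {N x} → 1 ≤ x → x ≤ N → ∃[ i ] suc (toℕ {N} i) ≡ x
positive-index {x = suc x} _ x<N = fromℕ< x<N , cong suc (toℕ-fromℕ< x<N)

-- Only divisors in {1, ..., N} are counted, so the index range does not depend on n. It is applied
-- with N = H, where the divisors are the distances |x - y| < H.
τ : ℕ → ℕ → ℕ
τ N n = ∑[ i < N ] 𝟙 (suc (toℕ i) ∣? n)

-- Take u = gcd(δ, a) and v = δ / u. Then v is coprime to a / u and divides (a / u) b, so it divides
-- b.
divisor-of-product : ∀ {δ a b} → 1 ≤ δ → δ ∣ℕ a * b → ∃[ u ] ∃[ v ] (u ∣ℕ a × v ∣ℕ b × u * v ≡ δ)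
divisor-of-product {δ} {a} {b} δ≥1 δ∣ab with gcd[m,n]∣m δ a | gcd[m,n]∣n δ a
... | divides v δ≡vg | divides a′ a≡a′g =
  g , v , divides a′ a≡a′g
    , coprime-divisor v⊥a′ (*-cancelˡ-∣ g (subst (_∣ℕ g * (a′ * b)) (trans δ≡vg (*-comm v g)) (subst (δ ∣ℕ_) regroup δ∣ab)))
    , trans (*-comm g v) (sym δ≡vg)
  where
  g = gcd δ a
  instance
    g≢0 : NonZero g
    g≢0 = ≢-nonZero (gcd[m,n]≢0 δ a (inj₁ (λ δ≡0 → case subst (1 ≤_) δ≡0 δ≥1 of λ ())))
  regroup : a * b ≡ g * (a′ * b)
  regroup = trans (cong (_* b) (trans a≡a′g (*-comm a′ g))) (*-assoc g a′ b)
  v⊥a′ : Coprime v a′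
  v⊥a′ = GCD≡1⇒coprime (GCD-* {c = g} (subst (GCD (v * g) (a′ * g)) (sym (*-identityˡ g))
           (subst (λ x → GCD x (a′ * g) g) δ≡vg (subst (λ x → GCD δ x g) a≡a′g (gcd-GCD δ a)))))

-- Every divisor k of a b is a product i j with i dividing a and j dividing b, and a pair (i, j)
-- yields only one k. The sum over triples with i j = k compares the two counts.
τ-submultiplicative : ∀ N a b → τ N (a * b) ≤ τ N a * τ N b
τ-submultiplicative N a b = begin
  ∑[ k < N ] 𝟙 (suc (toℕ k) ∣? a * b)
    ≤⟨ sum-mono cover ⟩
  ∑[ k < N ] ∑[ i < N ] ∑[ j < N ] (α i * β j * 𝟙 (prod? i j k))
    ≡⟨ ∑-comm (λ k i → ∑[ j < N ] (α i * β j * 𝟙 (prod? i j k))) ⟩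
  ∑[ i < N ] ∑[ k < N ] ∑[ j < N ] (α i * β j * 𝟙 (prod? i j k))
    ≡⟨ sum-cong-≗ (λ i → ∑-comm (λ k j → α i * β j * 𝟙 (prod? i j k))) ⟩
  ∑[ i < N ] ∑[ j < N ] ∑[ k < N ] (α i * β j * 𝟙 (prod? i j k))
    ≤⟨ sum-mono (λ i → sum-mono (λ j → unique i j)) ⟩
  ∑[ i < N ] ∑[ j < N ] (α i * β j)
    ≡⟨ sum-cong-≗ (λ i → sym (*-distribˡ-sum (α i) β)) ⟩
  ∑[ i < N ] (α i * sum β)
    ≡⟨ *-distribʳ-sum (sum β) α ⟨
  sum α * sum β ∎
  where
  open ≤-Reasoning
  α β : Fin N → ℕ
  α i = 𝟙 (suc (toℕ i) ∣? a)
  β j = 𝟙 (suc (toℕ j) ∣? b)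
  prod? : ∀ (i j k : Fin N) → Dec (suc (toℕ i) * suc (toℕ j) ≡ suc (toℕ k))
  prod? i j k = suc (toℕ i) * suc (toℕ j) ≟ suc (toℕ k)
  unique : ∀ i j → ∑[ k < N ] (α i * β j * 𝟙 (prod? i j k)) ≤ α i * β j
  unique i j = begin
    ∑[ k < N ] (α i * β j * 𝟙 (prod? i j k)) ≡⟨ *-distribˡ-sum (α i * β j) (𝟙 ∘ prod? i j) ⟨
    α i * β j * sum (𝟙 ∘ prod? i j)
      ≤⟨ *-monoʳ-≤ (α i * β j) (sum-𝟙-unique (prod? i j) (λ p q → toℕ-injective (suc-injective (trans (sym p) q)))) ⟩
    α i * β j * 1                          ≡⟨ *-identityʳ _ ⟩
    α i * β j                              ∎
  cover : ∀ k → 𝟙 (suc (toℕ k) ∣? a * b) ≤ ∑[ i < N ] ∑[ j < N ] (α i * β j * 𝟙 (prod? i j k))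
  cover k = 𝟙≤ (suc (toℕ k) ∣? a * b) λ k∣ab → case divisor-of-product (s≤s z≤n) k∣ab of λ where
    (zero , v , u∣a , v∣b , ())
    (suc u , zero , u∣a , v∣b , uv≡k) → case trans (sym (*-zeroʳ u)) uv≡k of λ ()
    (u@(suc _) , v@(suc _) , u∣a , v∣b , uv≡k) →
      case positive-index {N} {u} (s≤s z≤n) (≤-trans (m≤m*n u v) (≤-trans (≤-reflexive uv≡k) (toℕ<n k)))
         , positive-index {N} {v} (s≤s z≤n) (≤-trans (m≤n*m v u) (≤-trans (≤-reflexive uv≡k) (toℕ<n k))) of λ where
        ((i , i≡u) , (j , j≡v)) → ≤-trans
          (*-mono-≤ (*-mono-≤ (𝟙-yes (suc (toℕ i) ∣? a) (subst (_∣ℕ a) (sym i≡u) u∣a))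
                              (𝟙-yes (suc (toℕ j) ∣? b) (subst (_∣ℕ b) (sym j≡v) v∣b)))
                    (𝟙-yes (prod? i j k) (trans (cong₂ _*_ i≡u j≡v) uv≡k)))
          (≤-trans (term≤sum (λ j → α i * β j * 𝟙 (prod? i j k)) j)
                   (term≤sum (λ i → ∑[ j < N ] (α i * β j * 𝟙 (prod? i j k))) i))

τ-1 : ∀ N → τ N 1 ≤ 1
τ-1 N = sum-𝟙-unique {N} (λ i → suc (toℕ i) ∣? 1)
  (λ p q → toℕ-injective (suc-injective (trans (∣1⇒≡1 p) (sym (∣1⇒≡1 q)))))

-- The prime p divides δ q but not q, so it divides δ; cancelling one p on both sides lowers the
-- exponent.
cofactor-of-prime-power : ∀ {p} → Prime p → ∀ e {δ q} → δ * q ≡ p ^ e → ¬ p ∣ℕ q → q ≡ 1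
cofactor-of-prime-power p-prime zero    {δ} {q} δq≡1 p∤q = m*n≡1⇒n≡1 δ q δq≡1
cofactor-of-prime-power {p} p-prime (suc e) {δ} {q} δq≡pᵉ⁺¹ p∤q
  with euclidsLemma δ q p-prime (subst (p ∣ℕ_) (sym δq≡pᵉ⁺¹) (m∣m*n (p ^ e)))
... | inj₂ p∣q = contradiction p∣q p∤q
... | inj₁ (divides δ′ δ≡δ′p) = cofactor-of-prime-power p-prime e {δ′} {q} (*-cancelˡ-≡ (δ′ * q) (p ^ e) p (begin
  p * (δ′ * q) ≡⟨ *-assoc p δ′ q ⟨
  p * δ′ * q   ≡⟨ cong (_* q) (trans (*-comm p δ′) (sym δ≡δ′p)) ⟩
  δ * q        ≡⟨ δq≡pᵉ⁺¹ ⟩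
  p * p ^ e    ∎)) p∤q
  where
  open ≡-Reasoning
  instance _ = prime⇒nonZero p-prime

divisor-of-prime-power : ∀ {p} → Prime p → ∀ e {δ} → δ ∣ℕ p ^ suc e → δ ∣ℕ p ^ e ⊎ δ ≡ p ^ suc e
divisor-of-prime-power {p} p-prime e {δ} (divides q pᵉ⁺¹≡qδ) with p ∣? q
... | no p∤q = inj₂ (trans (sym (*-identityˡ δ)) (trans (cong (_* δ) (sym q≡1)) (sym pᵉ⁺¹≡qδ)))
  where q≡1 = cofactor-of-prime-power p-prime (suc e) {δ} {q} (trans (*-comm δ q) (sym pᵉ⁺¹≡qδ)) p∤q
... | yes (divides q′ q≡q′p) = inj₁ (divides q′ (*-cancelˡ-≡ (p ^ e) (q′ * δ) p (begin
  p * p ^ e    ≡⟨ pᵉ⁺¹≡qδ ⟩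
  q * δ        ≡⟨ cong (_* δ) (trans q≡q′p (*-comm q′ p)) ⟩
  p * q′ * δ   ≡⟨ *-assoc p q′ δ ⟩
  p * (q′ * δ) ∎)))
  where
  open ≡-Reasoning
  instance _ = prime⇒nonZero p-prime

τ-prime-power : ∀ N {p} → Prime p → ∀ e → τ N (p ^ e) ≤ suc e
τ-prime-power N p-prime zero = τ-1 N
τ-prime-power N {p} p-prime (suc e) = begin
  ∑[ i < N ] 𝟙 (suc (toℕ i) ∣? p ^ suc e)
    ≤⟨ sum-mono (λ i → 𝟙≤ (suc (toℕ i) ∣? p ^ suc e) λ i∣ → case divisor-of-prime-power p-prime e i∣ of λ where
         (inj₁ i∣pᵉ) → ≤-trans (𝟙-yes (suc (toℕ i) ∣? p ^ e) i∣pᵉ) (m≤n+m _ _)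
         (inj₂ i≡)   → ≤-trans (𝟙-yes (top? i) i≡) (m≤m+n _ _)) ⟩
  ∑[ i < N ] (𝟙 (top? i) + 𝟙 (suc (toℕ i) ∣? p ^ e))
    ≡⟨ ∑-distrib-+ (𝟙 ∘ top?) _ ⟩
  sum (𝟙 ∘ top?) + τ N (p ^ e)
    ≤⟨ +-mono-≤ (sum-𝟙-unique top? (λ p q → toℕ-injective (suc-injective (trans p (sym q))))) (τ-prime-power N p-prime e) ⟩
  suc (suc e) ∎
  where
  open ≤-Reasoning
  top? : ∀ (i : Fin N) → Dec (suc (toℕ i) ≡ p ^ suc e)
  top? i = suc (toℕ i) ≟ p ^ suc e

n<2^n : ∀ n → n < 2 ^ n
n<2^n zero    = s≤s z≤n
n<2^n (suc n) = begin-strict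
  suc n           ≤⟨ n<2^n n ⟩
  2 ^ n           <⟨ m<m+n (2 ^ n) (m^n>0 2 n) ⟩
  2 ^ n + 2 ^ n   ≡⟨ cong (_+_ (2 ^ n)) (+-identityʳ (2 ^ n)) ⟨
  2 ^ suc n       ∎
  where open ≤-Reasoning

^-distribʳ-* : ∀ n a b → (a * b) ^ n ≡ a ^ n * b ^ n
^-distribʳ-* zero    a b = refl
^-distribʳ-* (suc n) a b = trans (cong (a * b *_) (^-distribʳ-* n a b)) (swap a b (a ^ n) (b ^ n))
  where
  swap : ∀ a b x y → a * b * (x * y) ≡ a * x * (b * y)
  swap = ℕ-Solver.solve-∀

-- With e = e % M + (e / M) * M one has e + 1 ≤ M 2^(e / M).
suc-power≤exponential : ∀ M .{{_ : NonZero M}} e → suc e ^ M ≤ M ^ M * 2 ^ e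
suc-power≤exponential M e = begin
  suc e ^ M                     ≤⟨ ^-monoˡ-≤ M base ⟩
  (M * 2 ^ (e / M)) ^ M         ≡⟨ ^-distribʳ-* M M (2 ^ (e / M)) ⟩
  M ^ M * (2 ^ (e / M)) ^ M     ≡⟨ cong (M ^ M *_) (^-*-assoc 2 (e / M) M) ⟩
  M ^ M * 2 ^ (e / M * M)       ≤⟨ *-monoʳ-≤ (M ^ M) (^-monoʳ-≤ 2 (≤-trans (m≤n+m _ (e % M)) (≤-reflexive (sym (m≡m%n+[m/n]*n e M))))) ⟩
  M ^ M * 2 ^ e                 ∎
  where
  open ≤-Reasoning
  base : suc e ≤ M * 2 ^ (e / M)
  base = begin
    suc e                     ≡⟨ cong suc (m≡m%n+[m/n]*n e M) ⟩
    suc (e % M) + e / M * M   ≤⟨ +-monoˡ-≤ (e / M * M) (m%n<n e M) ⟩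
    suc (e / M) * M           ≡⟨ *-comm (suc (e / M)) M ⟩
    M * suc (e / M)           ≤⟨ *-monoʳ-≤ M (n<2^n (e / M)) ⟩
    M * 2 ^ (e / M)           ∎

extract-power : ∀ {i} → 2 ≤ i → ∀ n → .{{NonZero n}} → ∃[ e ] ∃[ r ] (n ≡ i ^ e * r × ¬ i ∣ℕ r)
extract-power {i} i≥2 = <-rec (λ n → .{{NonZero n}} → ∃[ e ] ∃[ r ] (n ≡ i ^ e * r × ¬ i ∣ℕ r)) step
  where
  step : ∀ n → (∀ {q} → q < n → .{{NonZero q}} → ∃[ e ] ∃[ r ] (q ≡ i ^ e * r × ¬ i ∣ℕ r)) →
         .{{NonZero n}} → ∃[ e ] ∃[ r ] (n ≡ i ^ e * r × ¬ i ∣ℕ r)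
  step n rec with i ∣? n
  ... | no i∤n = 0 , n , sym (+-identityʳ n) , i∤n
  ... | yes (divides zero n≡0) = contradiction n≡0 (≢-nonZero⁻¹ n)
  ... | yes (divides q@(suc _) n≡qi) with rec {q} (subst (q <_) (sym n≡qi) (m<m*n q i i≥2))
  ...   | e , r , q≡ , i∤r = suc e , r , trans n≡qi (trans (*-comm q i) (trans (cong (i *_) q≡) (sym (*-assoc i (i ^ e) r)))) , i∤r

module _ (M : ℕ) .{{_ : NonZero M}} where

  -- A prime p ≥ 2^M at most doubles τ, hence multiplies τ^M by at most p; each
  -- smaller prime costs a constant factor.
  DivisorBound : ℕ → Set
  DivisorBound i = ∃[ C ] ∀ n → .{{NonZero n}} → i Rough n → ∀ N → τ N n ^ M ≤ C * n

  -- Prime factors are split off one at a time, with multiplicity: since submultiplicativity holds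
  -- for arbitrary factors, repeated primes are treated like distinct ones.
  divisor-bound-rough : DivisorBound (2 ^ M)
  divisor-bound-rough = 1 , λ n rough N → let open PrimeFactorisation (factorise n) in
    subst (λ n → τ N n ^ M ≤ 1 * n) (sym isFactorisation)
      (≤-trans (bound N factors factorsPrime (subst ((2 ^ M) Rough_) isFactorisation rough)) (≤-reflexive (sym (*-identityˡ _))))
    where
    bound : ∀ N ps → All Prime ps → (2 ^ M) Rough product ps → τ N (product ps) ^ M ≤ product ps
    bound N [] [] rough = ≤-trans (^-monoˡ-≤ M (τ-1 N)) (≤-reflexive (^-zeroˡ M))
    bound N (p ∷ ps) (p-prime ∷ primes) rough = begin
      τ N (p * product ps) ^ M            ≤⟨ ^-monoˡ-≤ M (τ-submultiplicative N p (product ps)) ⟩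
      (τ N p * τ N (product ps)) ^ M      ≡⟨ ^-distribʳ-* M (τ N p) _ ⟩
      τ N p ^ M * τ N (product ps) ^ M    ≤⟨ *-mono-≤ (^-monoˡ-≤ M τp≤2) (bound N ps primes (rough∧∣⇒rough rough (n∣m*n p))) ⟩
      2 ^ M * product ps                  ≤⟨ *-monoˡ-≤ (product ps) p≥2^M ⟩
      p * product ps                      ∎
      where
      open ≤-Reasoning
      τp≤2 : τ N p ≤ 2
      τp≤2 = subst (λ x → τ N x ≤ 2) (*-identityʳ p) (τ-prime-power N p-prime 1)
      p≥2^M : 2 ^ M ≤ p
      p≥2^M = ≮⇒≥ (λ p<2^M → rough (record { nontrivial = prime⇒nonTrivial p-prime ; divisor-< = p<2^M ; divisor-∣ = m∣m*n (product ps) }))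

  -- Write n = i^e r with i not dividing r, so that r is (i+1)-rough. The power i^e contributes at
  -- most (e + 1)^M ≤ M^M 2^e ≤ M^M i^e, so passing from i + 1 to i costs the constant factor M^M.
  divisor-bound-step : ∀ i → 2 ≤ i → DivisorBound (suc i) → DivisorBound i
  divisor-bound-step i i≥2 (C , bound) = M ^ M * C , λ n rough N → case extract-power i≥2 n of λ where
      (e , r , n≡iᵉr , i∤r) → main n rough N e r n≡iᵉr i∤r
    where
    open ≤-Reasoning
    instance
      i-nonTrivial : NonTrivial i
      i-nonTrivial = n>1⇒nonTrivial i≥2
    -- If e is positive, then i divides the i-rough number n, which makes i prime; a composite i
    -- occurs only with e = 0.
    τ-power : ∀ N e r n → n ≡ i ^ e * r → i Rough n → τ N (i ^ e) ≤ suc e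
    τ-power N zero    r n n≡ rough = τ-1 N
    τ-power N (suc e) r n n≡ rough = τ-prime-power N (rough∧∣⇒prime rough (subst (i ∣ℕ_) (sym n≡) (∣-trans (m∣m*n (i ^ e)) (m∣m*n r)))) (suc e)
    main : ∀ n → .{{NonZero n}} → i Rough n → ∀ N e r → n ≡ i ^ e * r → ¬ i ∣ℕ r → τ N n ^ M ≤ M ^ M * C * n
    main n rough N e zero n≡ i∤r = contradiction (i ∣0) i∤r
    main n rough N e r@(suc _) n≡ i∤r = begin
      τ N n ^ M                            ≡⟨ cong (λ x → τ N x ^ M) n≡ ⟩
      τ N (i ^ e * r) ^ M                  ≤⟨ ^-monoˡ-≤ M (τ-submultiplicative N (i ^ e) r) ⟩
      (τ N (i ^ e) * τ N r) ^ M            ≡⟨ ^-distribʳ-* M (τ N (i ^ e)) (τ N r) ⟩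
      τ N (i ^ e) ^ M * τ N r ^ M
        ≤⟨ *-mono-≤ (^-monoˡ-≤ M (τ-power N e r n n≡ rough))
                    (bound r (∤⇒rough-suc i∤r (rough∧∣⇒rough rough (subst (r ∣ℕ_) (sym n≡) (n∣m*n (i ^ e))))) N) ⟩
      suc e ^ M * (C * r)                  ≤⟨ *-monoˡ-≤ (C * r) (suc-power≤exponential M e) ⟩
      M ^ M * 2 ^ e * (C * r)              ≤⟨ *-monoˡ-≤ (C * r) (*-monoʳ-≤ (M ^ M) (^-monoˡ-≤ e i≥2)) ⟩
      M ^ M * i ^ e * (C * r)              ≡⟨ swap (M ^ M) (i ^ e) C r ⟩
      M ^ M * C * (i ^ e * r)              ≡⟨ cong (M ^ M * C *_) n≡ ⟨
      M ^ M * C * n                        ∎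
      where
      swap : ∀ a x c r → a * x * (c * r) ≡ a * c * (x * r)
      swap = ℕ-Solver.solve-∀

  divisor-bound : ∃[ C ] ∀ n → .{{NonZero n}} → ∀ N → τ N n ^ M ≤ C * n
  divisor-bound with descend (2 ^ M ∸ 2) 2 ≤-refl (m+[n∸m]≡n (^-monoʳ-≤ 2 (>-nonZero⁻¹ M)))
    where
    descend : ∀ j i → 2 ≤ i → i + j ≡ 2 ^ M → DivisorBound i
    descend zero    i i≥2 eq = subst DivisorBound (trans (sym eq) (+-identityʳ i)) divisor-bound-rough
    descend (suc j) i i≥2 eq = divisor-bound-step i i≥2 (descend j (suc i) (m≤n⇒m≤1+n i≥2) (trans (sym (+-suc i j)) eq))
  ... | C , bound = C , λ n N → bound n 2-rough N

-- Rational powers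

toℚᵘ-ℕ→ℚ : ∀ n → toℚᵘ (ℕ→ℚ n) ≃ mkℚᵘ (+ n) 0
toℚᵘ-ℕ→ℚ n = ℚ.toℚᵘ-fromℚᵘ (mkℚᵘ (+ n) 0)

ℕ→ℚ-+ : ∀ a b → ℕ→ℚ (a + b) ≡ ℕ→ℚ a +ℚ ℕ→ℚ b
ℕ→ℚ-+ a b = ℚ.toℚᵘ-injective (begin-equality
  toℚᵘ (ℕ→ℚ (a + b))                ≃⟨ toℚᵘ-ℕ→ℚ (a + b) ⟩
  mkℚᵘ (+ (a + b)) 0                ≃⟨ *≡* (cong (ℤ._* + 1) (cong₂ ℤ._+_ (sym (ℤ.*-identityʳ (+ a))) (sym (ℤ.*-identityʳ (+ b))))) ⟩
  mkℚᵘ (+ a) 0 ℚᵘ.+ mkℚᵘ (+ b) 0      ≃⟨ ℚᵘ.+-cong (toℚᵘ-ℕ→ℚ a) (toℚᵘ-ℕ→ℚ b) ⟨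
  toℚᵘ (ℕ→ℚ a) ℚᵘ.+ toℚᵘ (ℕ→ℚ b)      ≃⟨ ℚ.toℚᵘ-homo-+ (ℕ→ℚ a) (ℕ→ℚ b) ⟨
  toℚᵘ (ℕ→ℚ a +ℚ ℕ→ℚ b)               ∎)
  where open ℚᵘ.≤-Reasoning

ℕ→ℚ-* : ∀ a b → ℕ→ℚ (a * b) ≡ ℕ→ℚ a *ℚ ℕ→ℚ b
ℕ→ℚ-* a b = ℚ.toℚᵘ-injective (begin-equality
  toℚᵘ (ℕ→ℚ (a * b))                ≃⟨ toℚᵘ-ℕ→ℚ (a * b) ⟩
  mkℚᵘ (+ (a * b)) 0                ≃⟨ *≡* (cong (ℤ._* + 1) (ℤ.pos-* a b)) ⟩
  mkℚᵘ (+ a) 0 ℚᵘ.* mkℚᵘ (+ b) 0      ≃⟨ ℚᵘ.*-cong (toℚᵘ-ℕ→ℚ a) (toℚᵘ-ℕ→ℚ b) ⟨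
  toℚᵘ (ℕ→ℚ a) ℚᵘ.* toℚᵘ (ℕ→ℚ b)      ≃⟨ ℚ.toℚᵘ-homo-* (ℕ→ℚ a) (ℕ→ℚ b) ⟨
  toℚᵘ (ℕ→ℚ a *ℚ ℕ→ℚ b)               ∎)
  where open ℚᵘ.≤-Reasoning

ℕ→ℚ-mono : ∀ {a b} → a ≤ b → ℕ→ℚ a ≤ℚ ℕ→ℚ b
ℕ→ℚ-mono {a} {b} a≤b = ℚ.toℚᵘ-cancel-≤ (begin
  toℚᵘ (ℕ→ℚ a)      ≃⟨ toℚᵘ-ℕ→ℚ a ⟩
  mkℚᵘ (+ a) 0      ≤⟨ *≤* (ℤ.*-monoʳ-≤-nonNeg (+ 1) (ℤ.+≤+ a≤b)) ⟩
  mkℚᵘ (+ b) 0      ≃⟨ toℚᵘ-ℕ→ℚ b ⟨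
  toℚᵘ (ℕ→ℚ b)      ∎)
  where open ℚᵘ.≤-Reasoning

0≤ℕ→ℚ : ∀ n → 0ℚ ≤ℚ ℕ→ℚ n
0≤ℕ→ℚ n = ℕ→ℚ-mono {0} {n} z≤n

*ℚ-mono-≤ : ∀ {p q r s} → 0ℚ ≤ℚ p → 0ℚ ≤ℚ s → p ≤ℚ q → r ≤ℚ s → p *ℚ r ≤ℚ q *ℚ s
*ℚ-mono-≤ {p} {q} {r} {s} 0≤p 0≤s p≤q r≤s = ℚ.≤-trans
  (ℚ.*-monoˡ-≤-nonNeg p {{nonNegative 0≤p}} r≤s)
  (ℚ.*-monoʳ-≤-nonNeg s {{nonNegative 0≤s}} p≤q)

0≤*ℚ : ∀ {p q} → 0ℚ ≤ℚ p → 0ℚ ≤ℚ q → 0ℚ ≤ℚ p *ℚ q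
0≤*ℚ {p} {q} 0≤p 0≤q = ℚ.≤-trans (ℚ.≤-reflexive (sym (ℚ.*-zeroˡ 0ℚ))) (*ℚ-mono-≤ ℚ.≤-refl 0≤q 0≤p 0≤q)

0≤1ℚ : 0ℚ ≤ℚ 1ℚ
0≤1ℚ = ℕ→ℚ-mono {0} {1} z≤n

^ℚ-nonNeg : ∀ {p} → 0ℚ ≤ℚ p → ∀ n → 0ℚ ≤ℚ p ^ℚ n
^ℚ-nonNeg 0≤p zero    = 0≤1ℚ
^ℚ-nonNeg 0≤p (suc n) = 0≤*ℚ 0≤p (^ℚ-nonNeg 0≤p n)

^ℚ-pos : ∀ {p} → 0ℚ <ℚ p → ∀ n → 0ℚ <ℚ p ^ℚ n
^ℚ-pos {p} 0<p zero    = ℚ.positive⁻¹ 1ℚ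
^ℚ-pos {p} 0<p (suc n) = ℚ.positive⁻¹ _ {{ℚ.pos*pos⇒pos p {{positive 0<p}} (p ^ℚ n) {{positive (^ℚ-pos 0<p n)}}}}

^ℚ-mono-≤ : ∀ {p q} → 0ℚ ≤ℚ p → p ≤ℚ q → ∀ n → p ^ℚ n ≤ℚ q ^ℚ n
^ℚ-mono-≤ 0≤p p≤q zero    = ℚ.≤-refl
^ℚ-mono-≤ 0≤p p≤q (suc n) = *ℚ-mono-≤ 0≤p (^ℚ-nonNeg (ℚ.≤-trans 0≤p p≤q) n) p≤q (^ℚ-mono-≤ 0≤p p≤q n)

-- This takes the place of n-th roots, which rational numbers need not have: inequalities are proved
-- for powers and then cancelled.
^ℚ-cancel-≤ : ∀ {p q} → 0ℚ ≤ℚ q → ∀ n .{{_ : NonZero n}} → p ^ℚ n ≤ℚ q ^ℚ n → p ≤ℚ q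
^ℚ-cancel-≤ {p} {q} 0≤q (suc n) pⁿ≤qⁿ = ℚ.≮⇒≥ λ q<p → ℚ.<-irrefl refl (ℚ.<-≤-trans
  (ℚ.≤-<-trans (ℚ.*-monoˡ-≤-nonNeg q {{nonNegative 0≤q}} (^ℚ-mono-≤ 0≤q (ℚ.<⇒≤ q<p) n))
               (ℚ.*-monoˡ-<-pos (p ^ℚ n) {{positive (^ℚ-pos (ℚ.≤-<-trans 0≤q q<p) n)}} q<p))
  pⁿ≤qⁿ)

^ℚ-distribʳ-* : ∀ n p q → (p *ℚ q) ^ℚ n ≡ (p ^ℚ n) *ℚ (q ^ℚ n)
^ℚ-distribʳ-* zero    p q = refl
^ℚ-distribʳ-* (suc n) p q = trans (cong (p *ℚ q *ℚ_) (^ℚ-distribʳ-* n p q)) (interchange p q (p ^ℚ n) (q ^ℚ n))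

^ℚ-+ : ∀ p a b → p ^ℚ (a + b) ≡ (p ^ℚ a) *ℚ (p ^ℚ b)
^ℚ-+ p zero    b = sym (ℚ.*-identityˡ _)
^ℚ-+ p (suc a) b = trans (cong (p *ℚ_) (^ℚ-+ p a b)) (sym (ℚ.*-assoc p _ _))

1^ℚ : ∀ n → 1ℚ ^ℚ n ≡ 1ℚ
1^ℚ zero    = refl
1^ℚ (suc n) = trans (ℚ.*-identityˡ _) (1^ℚ n)

^ℚ-* : ∀ p a b → (p ^ℚ a) ^ℚ b ≡ p ^ℚ (a * b)
^ℚ-* p a zero    = cong (p ^ℚ_) (sym (*-zeroʳ a))
^ℚ-* p a (suc b) = trans (cong ((p ^ℚ a) *ℚ_) (^ℚ-* p a b)) (trans (sym (^ℚ-+ p a (a * b))) (cong (p ^ℚ_) (sym (*-suc a b))))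

ℕ→ℚ-^ : ∀ a n → ℕ→ℚ (a ^ n) ≡ ℕ→ℚ a ^ℚ n
ℕ→ℚ-^ a zero    = refl
ℕ→ℚ-^ a (suc n) = trans (ℕ→ℚ-* a (a ^ n)) (cong (ℕ→ℚ a *ℚ_) (ℕ→ℚ-^ a n))

-- Short integer relations

dot : ∀ {n} → (Fin n → ℤ) → (Fin n → ℤ) → ℤ
dot {zero}  c v = 0ℤ
dot {suc n} c v = c zero ℤ.* v zero ℤ.+ dot (c ∘ suc) (v ∘ suc)

dot-linear : ∀ {n} (c u v : Fin n → ℤ) α β →
             dot c (λ j → α ℤ.* u j ℤ.- β ℤ.* v j) ≡ α ℤ.* dot c u ℤ.- β ℤ.* dot c v
dot-linear {zero}  c u v α β = vanish α β
  where
  vanish : ∀ α β → 0ℤ ≡ α ℤ.* 0ℤ ℤ.- β ℤ.* 0ℤ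
  vanish = ℤ-Solver.solve-∀
dot-linear {suc n} c u v α β =
  trans (cong (ℤ._+_ (c zero ℤ.* (α ℤ.* u zero ℤ.- β ℤ.* v zero))) (dot-linear (c ∘ suc) (u ∘ suc) (v ∘ suc) α β))
        (regroup (c zero) (u zero) (v zero) α β _ _)
  where
  regroup : ∀ c u v α β x y → c ℤ.* (α ℤ.* u ℤ.- β ℤ.* v) ℤ.+ (α ℤ.* x ℤ.- β ℤ.* y)
                             ≡ α ℤ.* (c ℤ.* u ℤ.+ x) ℤ.- β ℤ.* (c ℤ.* v ℤ.+ y)
  regroup = ℤ-Solver.solve-∀

dot-scaleˡ : ∀ {n} k (c v : Fin n → ℤ) → dot (λ j → k ℤ.* c j) v ≡ k ℤ.* dot c v
dot-scaleˡ {zero}  k c v = sym (ℤ.*-zeroʳ k)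
dot-scaleˡ {suc n} k c v = trans (cong (ℤ._+_ (k ℤ.* c zero ℤ.* v zero)) (dot-scaleˡ k (c ∘ suc) (v ∘ suc)))
                                 (regroup k (c zero) (v zero) _)
  where
  regroup : ∀ k c v x → k ℤ.* c ℤ.* v ℤ.+ k ℤ.* x ≡ k ℤ.* (c ℤ.* v ℤ.+ x)
  regroup = ℤ-Solver.solve-∀

dot-scaleʳ : ∀ {n} k (c v : Fin n → ℤ) → dot c (λ j → k ℤ.* v j) ≡ k ℤ.* dot c v
dot-scaleʳ {zero}  k c v = sym (ℤ.*-zeroʳ k)
dot-scaleʳ {suc n} k c v = trans (cong (ℤ._+_ (c zero ℤ.* (k ℤ.* v zero))) (dot-scaleʳ k (c ∘ suc) (v ∘ suc)))
                                 (regroup k (c zero) (v zero) _)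
  where
  regroup : ∀ k c v x → c ℤ.* (k ℤ.* v) ℤ.+ k ℤ.* x ≡ k ℤ.* (c ℤ.* v ℤ.+ x)
  regroup = ℤ-Solver.solve-∀

∣dot∣≤ : ∀ {n} (c v : Fin n → ℤ) → ℤ.∣ dot c v ∣ ≤ sum (λ j → ℤ.∣ c j ∣ * ℤ.∣ v j ∣)
∣dot∣≤ {zero}  c v = z≤n
∣dot∣≤ {suc n} c v = ≤-trans (ℤ.∣i+j∣≤∣i∣+∣j∣ (c zero ℤ.* v zero) _)
  (+-mono-≤ (≤-reflexive (ℤ.∣i*j∣≡∣i∣*∣j∣ (c zero) (v zero))) (∣dot∣≤ (c ∘ suc) (v ∘ suc)))

-- The exponents start at 1, because constant terms cancel in every difference that occurs.
powers : ∀ {n} → ℤ → Fin n → ℤ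
powers x j = x ℤ.^ suc (toℕ j)

poly-powers : ∀ {n} (c : Fin (suc n) → ℤ) → Poly (suc n) (c (fromℕ n)) (λ x → dot c (powers x))
poly-powers c = poly-≈ refl (λ x → dot-scaleʳ x c (λ j → x ℤ.^ toℕ j)) (poly-x* (poly-dot c))
  where
  poly-dot : ∀ {n} (c : Fin (suc n) → ℤ) → Poly n (c (fromℕ n)) (λ x → dot c (λ j → x ℤ.^ toℕ j))
  poly-dot {zero}  c = const (λ x → trans (ℤ.+-identityʳ _) (ℤ.*-identityʳ (c zero)))
  poly-dot {suc n} c = horner (c zero) (poly-dot (c ∘ suc)) (λ x →
    cong₂ ℤ._+_ (ℤ.*-identityʳ (c zero)) (dot-scaleʳ x (c ∘ suc) (λ j → x ℤ.^ toℕ j)))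

-- Bound on the entries of an integer vector orthogonal to vectors with entries
-- at most B, obtained by fraction-free elimination of one coordinate at a time.
orthBound : ℕ → ℕ → ℕ
orthBound zero    B = 1
orthBound (suc n) B = suc n * (B * orthBound n (2 * (B * B)))

module _ {I : Set} (search : ∀ {P : I → Set} → (∀ i → Dec (P i)) → Dec (∃ P)) where

  -- The given c serves as a witness that the equations it satisfies admit a solution with nonzero
  -- last coordinate; its size does not enter the bound. If all rows orthogonal to c start with 0,
  -- the first coordinate of the solution is set to 0. Otherwise a pivot row p clears the first
  -- entry of each row by cross-multiplication, which turns the entry bound B into 2B². Coordinates
  -- are eliminated from the front, so the last one stays nonzero. `search` finds the pivot or shows
  -- that there is none.
  small-orthogonal : ∀ {n} (w : I → Fin (suc n) → ℤ) {B} → 1 ≤ B → (∀ i j → ℤ.∣ w i j ∣ ≤ B) →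
    (c : Fin (suc n) → ℤ) → c (fromℕ n) ≢ 0ℤ →
    ∃[ c′ ] (c′ (fromℕ n) ≢ 0ℤ × (∀ i → dot c (w i) ≡ 0ℤ → dot c′ (w i) ≡ 0ℤ) × (∀ j → ℤ.∣ c′ j ∣ ≤ orthBound n B))
  -- With one coordinate and c ≠ 0, orthogonality to c forces the row to vanish, so 1 is a solution.
  small-orthogonal {zero} w B≥1 w≤B c c≢0 = (λ _ → 1ℤ) , (λ ()) , orth , (λ _ → ≤-refl)
    where
    orth : ∀ i → dot c (w i) ≡ 0ℤ → dot (λ _ → 1ℤ) (w i) ≡ 0ℤ
    orth i cw≡0 with ℤ.i*j≡0⇒i≡0∨j≡0 (c zero) (trans (sym (ℤ.+-identityʳ _)) cw≡0)
    ... | inj₁ c≡0 = contradiction c≡0 c≢0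
    ... | inj₂ w≡0 = trans (ℤ.+-identityʳ _) (trans (ℤ.*-identityˡ (w i zero)) w≡0)
  small-orthogonal {suc n} w {B} B≥1 w≤B c c≢0
    with search (λ i → (dot c (w i) ℤ.≟ 0ℤ) ×-dec ¬? (w i zero ℤ.≟ 0ℤ))
  ... | no no-pivot = case small-orthogonal (λ i → w i ∘ suc) B₂≥1 (λ i j → ≤-trans (w≤B i (suc j)) B≤B₂) (c ∘ suc) c≢0 of λ where
      (c′ , c′≢0 , orth , bound) →
          (0ℤ Vector.∷ c′) , c′≢0
        , (λ i cw≡0 → trans (ℤ.+-identityˡ _) (orth i (tail-orth i cw≡0)))
        , λ { zero → z≤n ; (suc j) → ≤-trans (bound j) (≤-trans (m≤n*m _ B {{>-nonZero B≥1}}) (m≤m+n _ _)) }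
    where
    B₂ = 2 * (B * B)
    B≤B₂ : B ≤ B₂
    B≤B₂ = ≤-trans (m≤m*n B B {{>-nonZero B≥1}}) (m≤m+n (B * B) _)
    B₂≥1 : 1 ≤ B₂
    B₂≥1 = ≤-trans B≥1 B≤B₂
    tail-orth : ∀ i → dot c (w i) ≡ 0ℤ → dot (c ∘ suc) (w i ∘ suc) ≡ 0ℤ
    tail-orth i cw≡0 with w i zero ℤ.≟ 0ℤ
    ... | no w≢0  = contradiction (i , cw≡0 , w≢0) no-pivot
    ... | yes w≡0 = trans (sym (ℤ.+-identityˡ _)) (trans (cong (ℤ._+ dot (c ∘ suc) (w i ∘ suc)) (sym (trans (cong (c zero ℤ.*_) w≡0) (ℤ.*-zeroʳ (c zero))))) cw≡0)
  ... | yes (p , cp≡0 , p≢0) = case small-orthogonal w′ B₂≥1 w′≤B₂ (c ∘ suc) c≢0 of λ where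
      (c′ , c′≢0 , orth , bound) →
          extend c′
        , (λ eq → case ℤ.i*j≡0⇒i≡0∨j≡0 (w p zero) eq of λ where
            (inj₁ z) → p≢0 z
            (inj₂ z) → c′≢0 z)
        , (λ i cw≡0 → trans (extend-dot c′ i) (orth i (w′-orth i cw≡0)))
        , extend-bound c′ bound
    where
    B₂ = 2 * (B * B)
    B₂≥1 : 1 ≤ B₂
    B₂≥1 = ≤-trans (*-mono-≤ B≥1 B≥1) (m≤m+n (B * B) _)
    w′ : I → Fin (suc n) → ℤ
    w′ i j = w p zero ℤ.* w i (suc j) ℤ.- w i zero ℤ.* w p (suc j)
    w′≤B₂ : ∀ i j → ℤ.∣ w′ i j ∣ ≤ B₂
    w′≤B₂ i j = let open ≤-Reasoning in begin
      ℤ.∣ w′ i j ∣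
        ≤⟨ ℤ.∣i-j∣≤∣i∣+∣j∣ (w p zero ℤ.* w i (suc j)) (w i zero ℤ.* w p (suc j)) ⟩
      ℤ.∣ w p zero ℤ.* w i (suc j) ∣ + ℤ.∣ w i zero ℤ.* w p (suc j) ∣
        ≡⟨ cong₂ _+_ (ℤ.∣i*j∣≡∣i∣*∣j∣ (w p zero) _) (ℤ.∣i*j∣≡∣i∣*∣j∣ (w i zero) _) ⟩
      ℤ.∣ w p zero ∣ * ℤ.∣ w i (suc j) ∣ + ℤ.∣ w i zero ∣ * ℤ.∣ w p (suc j) ∣
        ≤⟨ +-mono-≤ (*-mono-≤ (w≤B p zero) (w≤B i (suc j))) (*-mono-≤ (w≤B i zero) (w≤B p (suc j))) ⟩
      B * B + B * B
        ≡⟨ cong (_+_ (B * B)) (+-identityʳ (B * B)) ⟨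
      B₂ ∎
    w′-orth : ∀ i → dot c (w i) ≡ 0ℤ → dot (c ∘ suc) (w′ i) ≡ 0ℤ
    w′-orth i cw≡0 = let open ≡-Reasoning in begin
      dot (c ∘ suc) (w′ i)
        ≡⟨ dot-linear (c ∘ suc) (w i ∘ suc) (w p ∘ suc) (w p zero) (w i zero) ⟩
      w p zero ℤ.* dot (c ∘ suc) (w i ∘ suc) ℤ.- w i zero ℤ.* dot (c ∘ suc) (w p ∘ suc)
        ≡⟨ complete (c zero) (w p zero) (w i zero) _ _ ⟩
      w p zero ℤ.* dot c (w i) ℤ.- w i zero ℤ.* dot c (w p)
        ≡⟨ cong₂ (λ x y → w p zero ℤ.* x ℤ.- w i zero ℤ.* y) cw≡0 cp≡0 ⟩
      w p zero ℤ.* 0ℤ ℤ.- w i zero ℤ.* 0ℤ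
        ≡⟨ vanish (w p zero) (w i zero) ⟩
      0ℤ ∎
      where
      complete : ∀ c p i x y → p ℤ.* x ℤ.- i ℤ.* y ≡ p ℤ.* (c ℤ.* i ℤ.+ x) ℤ.- i ℤ.* (c ℤ.* p ℤ.+ y)
      complete = ℤ-Solver.solve-∀
      vanish : ∀ p i → p ℤ.* 0ℤ ℤ.- i ℤ.* 0ℤ ≡ 0ℤ
      vanish = ℤ-Solver.solve-∀
    -- Orthogonality to the pivot row determines the first coordinate up to division by the pivot
    -- entry; multiplying the other coordinates by that entry clears the denominator.
    extend : (Fin (suc n) → ℤ) → Fin (suc (suc n)) → ℤ
    extend c′ zero    = ℤ.- dot c′ (w p ∘ suc)
    extend c′ (suc j) = w p zero ℤ.* c′ j
    extend-bound : ∀ c′ → (∀ j → ℤ.∣ c′ j ∣ ≤ orthBound n B₂) → ∀ j → ℤ.∣ extend c′ j ∣ ≤ suc n * (B * orthBound n B₂)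
    extend-bound c′ bound zero = let open ≤-Reasoning in begin
      ℤ.∣ ℤ.- dot c′ (w p ∘ suc) ∣                       ≡⟨ ℤ.∣-i∣≡∣i∣ (dot c′ (w p ∘ suc)) ⟩
      ℤ.∣ dot c′ (w p ∘ suc) ∣                           ≤⟨ ∣dot∣≤ c′ (w p ∘ suc) ⟩
      sum (λ j → ℤ.∣ c′ j ∣ * ℤ.∣ w p (suc j) ∣)           ≤⟨ sum-bound (λ j → *-mono-≤ (bound j) (w≤B p (suc j))) ⟩
      suc n * (orthBound n B₂ * B)                     ≡⟨ cong (suc n *_) (*-comm _ B) ⟩
      suc n * (B * orthBound n B₂)                     ∎
    extend-bound c′ bound (suc j) = let open ≤-Reasoning in begin
      ℤ.∣ w p zero ℤ.* c′ j ∣                            ≡⟨ ℤ.∣i*j∣≡∣i∣*∣j∣ (w p zero) (c′ j) ⟩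
      ℤ.∣ w p zero ∣ * ℤ.∣ c′ j ∣                          ≤⟨ *-mono-≤ (w≤B p zero) (bound j) ⟩
      B * orthBound n B₂                               ≤⟨ m≤m+n _ _ ⟩
      suc n * (B * orthBound n B₂)                     ∎
    extend-dot : ∀ c′ i → dot (extend c′) (w i) ≡ dot c′ (w′ i)
    extend-dot c′ i = let open ≡-Reasoning in begin
      ℤ.- dot c′ (w p ∘ suc) ℤ.* w i zero ℤ.+ dot (λ j → w p zero ℤ.* c′ j) (w i ∘ suc)
        ≡⟨ cong (ℤ._+_ (ℤ.- dot c′ (w p ∘ suc) ℤ.* w i zero)) (dot-scaleˡ (w p zero) c′ (w i ∘ suc)) ⟩
      ℤ.- dot c′ (w p ∘ suc) ℤ.* w i zero ℤ.+ w p zero ℤ.* dot c′ (w i ∘ suc)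
        ≡⟨ swap (dot c′ (w p ∘ suc)) (w i zero) (w p zero) _ ⟩
      w p zero ℤ.* dot c′ (w i ∘ suc) ℤ.- w i zero ℤ.* dot c′ (w p ∘ suc)
        ≡⟨ dot-linear c′ (w i ∘ suc) (w p ∘ suc) (w p zero) (w i zero) ⟨
      dot c′ (w′ i) ∎
      where
      swap : ∀ x i p y → ℤ.- x ℤ.* i ℤ.+ p ℤ.* y ≡ p ℤ.* y ℤ.- i ℤ.* x
      swap = ℤ-Solver.solve-∀

-- Boxes modulo m and the pigeonhole principle

∏ : ∀ {n} → (Fin n → ℕ) → ℕ
∏ {zero}  N = 1
∏ {suc n} N = N zero * ∏ (N ∘ suc)

encode : ∀ {n} (N : Fin n → ℕ) → (∀ j → Fin (N j)) → Fin (∏ N)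
encode {zero}  N b = zero
encode {suc n} N b = Fin.combine (b zero) (encode (N ∘ suc) (λ j → b (suc j)))

encode-injective : ∀ {n} (N : Fin n → ℕ) b b′ → encode N b ≡ encode N b′ → ∀ j → b j ≡ b′ j
encode-injective {suc n} N b b′ eq zero    = proj₁ (combine-injective (b zero) _ (b′ zero) _ eq)
encode-injective {suc n} N b b′ eq (suc j) = encode-injective (N ∘ suc) _ _ (proj₂ (combine-injective (b zero) _ (b′ zero) _ eq)) j

∣x-y∣-≤ : ∀ {x y} → x ≤ y → ℤ.∣ + x ℤ.- + y ∣ ≡ y ∸ x
∣x-y∣-≤ {x} {y} x≤y = trans (cong ℤ.∣_∣ (ℤ.m-n≡m⊖n x y)) (ℤ.∣⊖∣-≤ x≤y)

-- For x < m, `(x * N) / m` is the index of the box that contains x when the interval from 0 to m is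
-- cut into N boxes of length m / N. The conclusion is multiplied by N since m / N need not be an
-- integer.
same-box-≤ : ∀ m .{{_ : NonZero m}} N {x y} → x ≤ y → (x * N) / m ≡ (y * N) / m → N * ℤ.∣ + x ℤ.- + y ∣ < m
same-box-≤ m N {x} {y} x≤y eq = +-cancelˡ-< (x * N) (N * ℤ.∣ + x ℤ.- + y ∣) m (begin-strict
  x * N + N * ℤ.∣ + x ℤ.- + y ∣         ≡⟨ cong (λ z → x * N + N * z) (∣x-y∣-≤ x≤y) ⟩
  x * N + N * (y ∸ x)                 ≡⟨ cong (_+_ (x * N)) (*-comm N (y ∸ x)) ⟩
  x * N + (y ∸ x) * N                 ≡⟨ *-distribʳ-+ N x (y ∸ x) ⟨
  (x + (y ∸ x)) * N                   ≡⟨ cong (_* N) (m+[n∸m]≡n x≤y) ⟩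
  y * N                               ≡⟨ m≡m%n+[m/n]*n (y * N) m ⟩
  (y * N) % m + (y * N) / m * m       ≡⟨ cong (λ k → (y * N) % m + k * m) eq ⟨
  (y * N) % m + (x * N) / m * m       <⟨ +-monoˡ-< ((x * N) / m * m) (m%n<n (y * N) m) ⟩
  m + (x * N) / m * m                 ≤⟨ +-monoʳ-≤ m (≤-trans (m≤n+m _ _) (≤-reflexive (sym (m≡m%n+[m/n]*n (x * N) m)))) ⟩
  m + x * N                           ≡⟨ +-comm m (x * N) ⟩
  x * N + m                           ∎)
  where open ≤-Reasoning

same-box : ∀ m .{{_ : NonZero m}} N {x y} → (x * N) / m ≡ (y * N) / m → N * ℤ.∣ + x ℤ.- + y ∣ < m
same-box m N {x} {y} eq with ≤-total x y
... | inj₁ x≤y = same-box-≤ m N x≤y eq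
... | inj₂ y≤x = subst (λ z → N * z < m) (ℤ.∣i-j∣≡∣j-i∣ (+ y) (+ x)) (same-box-≤ m N y≤x (sym eq))

m∣i∧∣i∣<m⇒i≡0 : ∀ {m i} → + m ∣ℤ i → ℤ.∣ i ∣ < m → i ≡ 0ℤ
m∣i∧∣i∣<m⇒i≡0 {m} {i} m∣i ∣i∣<m with ℤ.∣ i ∣ in eq | ∣⇒∣ᵤ m∣i
... | zero  | _   = ℤ.∣i∣≡0⇒i≡0 eq
... | suc k | m∣k = contradiction (∣⇒≤ m∣k) (<⇒≱ ∣i∣<m)

dot-congruent : ∀ {n m} k (a c w : Fin n → ℤ) → (∀ j → + m ∣ℤ c j ℤ.- k ℤ.* a j) →
                + m ∣ℤ dot c w ℤ.- k ℤ.* dot a w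
dot-congruent {zero}  k a c w c≡ka = divides 0ℤ (vanish k)
  where
  vanish : ∀ k → 0ℤ ℤ.- k ℤ.* 0ℤ ≡ 0ℤ
  vanish = ℤ-Solver.solve-∀
dot-congruent {suc n} {m} k a c w c≡ka = subst (+ m ∣ℤ_) (regroup (c zero) k (a zero) (w zero) _ _)
  (∣m∣n⇒∣m+n (∣m⇒∣m*n (w zero) (c≡ka zero)) (dot-congruent k (a ∘ suc) (c ∘ suc) (w ∘ suc) (c≡ka ∘ suc)))
  where
  regroup : ∀ c k a w x y → (c ℤ.- k ℤ.* a) ℤ.* w ℤ.+ (x ℤ.- k ℤ.* y) ≡ (c ℤ.* w ℤ.+ x) ℤ.- k ℤ.* (a ℤ.* w ℤ.+ y)
  regroup = ℤ-Solver.solve-∀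

%-congruent : ∀ m .{{_ : NonZero m}} x → + m ∣ℤ + (x % m) ℤ.- + x
%-congruent m x = divides (ℤ.- + (x / m)) (begin
  + (x % m) ℤ.- + x                                  ≡⟨ cong (λ z → + (x % m) ℤ.- + z) (m≡m%n+[m/n]*n x m) ⟩
  + (x % m) ℤ.- + (x % m + x / m * m)                ≡⟨ cong (λ z → + (x % m) ℤ.- z) (trans (ℤ.pos-+ (x % m) _) (cong (ℤ._+_ (+ (x % m))) (ℤ.pos-* (x / m) m))) ⟩
  + (x % m) ℤ.- (+ (x % m) ℤ.+ + (x / m) ℤ.* + m)    ≡⟨ cancel (+ (x % m)) (+ (x / m)) (+ m) ⟩
  ℤ.- + (x / m) ℤ.* + m                              ∎)
  where
  open ≡-Reasoning
  cancel : ∀ r q m → r ℤ.- (r ℤ.+ q ℤ.* m) ≡ ℤ.- q ℤ.* m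
  cancel = ℤ-Solver.solve-∀

-- A short vector of the lattice { c : c ≡ q a (mod m) for some q }, found by
-- the pigeonhole principle, annihilates over ℤ every short w with a · w ≡ 0.
short-relation : ∀ {n} m .{{_ : NonZero m}} (a N : Fin (suc n) → ℕ) → Coprime m (a (fromℕ n)) →
  (∀ j → 1 ≤ N j) → ∏ N < m →
  ∃[ c ] (c (fromℕ n) ≢ 0ℤ × (∀ w → + m ∣ℤ dot (+_ ∘ a) w → (∀ j → suc n * ℤ.∣ w j ∣ ≤ N j) → dot c w ≡ 0ℤ))
short-relation {n} m a N m⊥a N≥1 ∏N<m = case pigeonhole ∏N<m (λ q → encode N (box q)) of λ where
    (q₁ , q₂ , q₁<q₂ , eq) → relation q₁ q₂ q₁<q₂ (encode-injective N (box q₁) (box q₂) eq)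
  where
  residue : Fin m → Fin (suc n) → ℕ
  residue q j = (toℕ q * a j) % m
  box< : ∀ q j → (residue q j * N j) / m < N j
  box< q j = m<n*o⇒m/o<n (subst (residue q j * N j <_) (*-comm m (N j))
                            (*-monoˡ-< (N j) {{>-nonZero (N≥1 j)}} (m%n<n (toℕ q * a j) m)))
  box : Fin m → ∀ j → Fin (N j)
  box q j = fromℕ< (box< q j)
  relation : ∀ q₁ q₂ → toℕ q₁ < toℕ q₂ → (∀ j → box q₁ j ≡ box q₂ j) →
    ∃[ c ] (c (fromℕ n) ≢ 0ℤ × (∀ w → + m ∣ℤ dot (+_ ∘ a) w → (∀ j → suc n * ℤ.∣ w j ∣ ≤ N j) → dot c w ≡ 0ℤ))
  relation q₁ q₂ q₁<q₂ same = c , c≢0 , orth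
    where
    c : Fin (suc n) → ℤ
    c j = + residue q₁ j ℤ.- + residue q₂ j
    k = + toℕ q₁ ℤ.- + toℕ q₂
    c≡ka : ∀ j → + m ∣ℤ c j ℤ.- k ℤ.* + a j
    c≡ka j = subst (+ m ∣ℤ_) eq
               (∣m∣n⇒∣m-n (%-congruent m (toℕ q₁ * a j)) (%-congruent m (toℕ q₂ * a j)))
      where
      regroup : ∀ r s x y a → (r ℤ.- x ℤ.* a) ℤ.- (s ℤ.- y ℤ.* a) ≡ (r ℤ.- s) ℤ.- (x ℤ.- y) ℤ.* a
      regroup = ℤ-Solver.solve-∀
      eq : (+ residue q₁ j ℤ.- + (toℕ q₁ * a j)) ℤ.- (+ residue q₂ j ℤ.- + (toℕ q₂ * a j)) ≡ c j ℤ.- k ℤ.* + a j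
      eq = trans (cong₂ (λ x y → (+ residue q₁ j ℤ.- x) ℤ.- (+ residue q₂ j ℤ.- y)) (ℤ.pos-* (toℕ q₁) (a j)) (ℤ.pos-* (toℕ q₂) (a j)))
                 (regroup (+ residue q₁ j) (+ residue q₂ j) (+ toℕ q₁) (+ toℕ q₂) (+ a j))
    Nc<m : ∀ j → N j * ℤ.∣ c j ∣ < m
    Nc<m j = same-box m (N j) {residue q₁ j} {residue q₂ j} (trans (sym (toℕ-fromℕ< (box< q₁ j))) (trans (cong toℕ (same j)) (toℕ-fromℕ< (box< q₂ j))))
    ∣k∣ : ℤ.∣ k ∣ ≡ toℕ q₂ ∸ toℕ q₁
    ∣k∣ = ∣x-y∣-≤ (<⇒≤ q₁<q₂)
    -- If the last entry vanished, m would divide k times the last entry of `a`, hence k by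
    -- coprimality; but k is the difference of two distinct elements of {0, ..., m - 1}.
    c≢0 : c (fromℕ n) ≢ 0ℤ
    c≢0 c≡0 = <⇒≱ q₁<q₂ (m∸n≡0⇒m≤n (trans (sym ∣k∣) (cong ℤ.∣_∣ k≡0)))
      where
      drop-zero : ∀ c k a → c ≡ 0ℤ → ℤ.- (c ℤ.- k ℤ.* a) ≡ k ℤ.* a
      drop-zero c k a refl = lemma k a
        where
        lemma : ∀ k a → ℤ.- (0ℤ ℤ.- k ℤ.* a) ≡ k ℤ.* a
        lemma = ℤ-Solver.solve-∀
      m∣ka : + m ∣ℤ k ℤ.* + a (fromℕ n)
      m∣ka = subst (+ m ∣ℤ_) (drop-zero (c (fromℕ n)) k (+ a (fromℕ n)) c≡0) (∣m⇒∣-m (c≡ka (fromℕ n)))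
      k≡0 : k ≡ 0ℤ
      k≡0 = m∣i∧∣i∣<m⇒i≡0 (∣ᵤ⇒∣ (coprime-divisor m⊥a (subst (_∣ℕ_ m) (trans (ℤ.∣i*j∣≡∣i∣*∣j∣ k (+ a (fromℕ n))) (*-comm ℤ.∣ k ∣ _)) (∣⇒∣ᵤ m∣ka))))
              (subst (_< m) (sym ∣k∣) (≤-<-trans (m∸n≤m (toℕ q₂) (toℕ q₁)) (toℕ<n q₂)))
    orth : ∀ w → + m ∣ℤ dot (+_ ∘ a) w → (∀ j → suc n * ℤ.∣ w j ∣ ≤ N j) → dot c w ≡ 0ℤ
    orth w m∣aw w≤N = m∣i∧∣i∣<m⇒i≡0
      (∣m+n∣n⇒∣m (dot-congruent k (+_ ∘ a) c w c≡ka) (∣m⇒∣-m (∣n⇒∣m*n k m∣aw)))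
      -- After multiplication by the number of coordinates, each term of c · w is at most N_j |c_j|
      -- ≤ m - 1, so |c · w| is at most their average and stays below m.
      (*-cancelˡ-< (suc n) ℤ.∣ dot c w ∣ m (begin-strict
        suc n * ℤ.∣ dot c w ∣                              ≤⟨ *-monoʳ-≤ (suc n) (∣dot∣≤ c w) ⟩
        suc n * sum (λ j → ℤ.∣ c j ∣ * ℤ.∣ w j ∣)            ≡⟨ *-distribˡ-sum (suc n) (λ j → ℤ.∣ c j ∣ * ℤ.∣ w j ∣) ⟩
        sum (λ j → suc n * (ℤ.∣ c j ∣ * ℤ.∣ w j ∣))          ≤⟨ sum-bound bound ⟩
        suc n * pred m                                   <⟨ *-monoʳ-< (suc n) (≤-reflexive (suc-pred m)) ⟩
        suc n * m                                        ∎))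
      where
      open ≤-Reasoning
      swap : ∀ n c w → n * (c * w) ≡ n * w * c
      swap = ℕ-Solver.solve-∀
      bound : ∀ j → suc n * (ℤ.∣ c j ∣ * ℤ.∣ w j ∣) ≤ pred m
      bound j = begin
        suc n * (ℤ.∣ c j ∣ * ℤ.∣ w j ∣)   ≡⟨ swap (suc n) ℤ.∣ c j ∣ ℤ.∣ w j ∣ ⟩
        suc n * ℤ.∣ w j ∣ * ℤ.∣ c j ∣     ≤⟨ *-monoˡ-≤ ℤ.∣ c j ∣ (w≤N j) ⟩
        N j * ℤ.∣ c j ∣                 ≤⟨ <⇒≤pred (Nc<m j) ⟩
        pred m                        ∎

-- The lifted polynomial

list-sum : ∀ {n} (f : Fin n → ℕ) → ListAction.sum (map f (allFin n)) ≡ sum f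
list-sum f = trans (cong ListAction.sum (map-tabulate (λ i → i) f)) (sum-tabulate f)
  where
  sum-tabulate : ∀ {n} (f : Fin n → ℕ) → ListAction.sum (List.tabulate f) ≡ sum f
  sum-tabulate {zero}  f = refl
  sum-tabulate {suc n} f = cong (_+_ (f zero)) (sum-tabulate (f ∘ suc))

pos-^ : ∀ x k → + (x ^ k) ≡ (+ x) ℤ.^ k
pos-^ x zero    = refl
pos-^ x (suc k) = trans (ℤ.pos-* x (x ^ k)) (cong (+ x ℤ.*_) (pos-^ x k))

evalPoly-dot : ∀ {d} (a : Fin (suc d) → ℕ) x →
               + evalPoly a x ≡ + a zero ℤ.+ dot (+_ ∘ a ∘ suc) (powers (+ x))
evalPoly-dot a x = trans (cong +_ (list-sum (λ i → a i * x ^ toℕ i)))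
  (trans (ℤ.pos-+ (a zero * 1) _) (cong₂ ℤ._+_ (cong +_ (*-identityʳ (a zero))) (pos-sum (a ∘ suc) (λ j → suc (toℕ j)))))
  where
  pos-sum : ∀ {n} (a e : Fin n → ℕ) → + sum (λ j → a j * x ^ e j) ≡ dot (+_ ∘ a) (λ j → (+ x) ℤ.^ e j)
  pos-sum {zero}  a e = refl
  pos-sum {suc n} a e = trans (ℤ.pos-+ (a zero * x ^ e zero) _)
    (cong₂ ℤ._+_ (trans (ℤ.pos-* (a zero) (x ^ e zero)) (cong (+ a zero ℤ.*_) (pos-^ x (e zero)))) (pos-sum (a ∘ suc) (e ∘ suc)))

dot-minus : ∀ {n} (c u v : Fin n → ℤ) → dot c (λ j → u j ℤ.- v j) ≡ dot c u ℤ.- dot c v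
dot-minus {zero}  c u v = refl
dot-minus {suc n} c u v = trans (cong (ℤ._+_ (c zero ℤ.* (u zero ℤ.- v zero))) (dot-minus (c ∘ suc) (u ∘ suc) (v ∘ suc)))
                                (regroup (c zero) (u zero) (v zero) _ _)
  where
  regroup : ∀ c u v x y → c ℤ.* (u ℤ.- v) ℤ.+ (x ℤ.- y) ≡ (c ℤ.* u ℤ.+ x) ℤ.- (c ℤ.* v ℤ.+ y)
  regroup = ℤ-Solver.solve-∀

≡%⇒∣- : ∀ {m} .{{_ : NonZero m}} {x y} → x % m ≡ y % m → + m ∣ℤ + x ℤ.- + y
≡%⇒∣- {m} {x} {y} eq = subst (+ m ∣ℤ_) (trans (cong (λ z → (+ z ℤ.- + y) ℤ.- (+ (x % m) ℤ.- + x)) (sym eq)) (regroup (+ (x % m)) (+ x) (+ y)))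
  (∣m∣n⇒∣m-n (%-congruent m y) (%-congruent m x))
  where
  regroup : ∀ r x y → (r ℤ.- y) ℤ.- (r ℤ.- x) ≡ x ℤ.- y
  regroup = ℤ-Solver.solve-∀

search-× : ∀ {A B : Set} → (∀ {P : A → Set} → (∀ i → Dec (P i)) → Dec (∃ P)) →
           (∀ {P : B → Set} → (∀ i → Dec (P i)) → Dec (∃ P)) →
           ∀ {P : A × B → Set} → (∀ i → Dec (P i)) → Dec (∃ P)
search-× searchA searchB P? = map′ (λ { (a , b , p) → (a , b) , p }) (λ { ((a , b) , p) → a , b , p })
                                   (searchA (λ a → searchB (λ b → P? (a , b))))

∣x-y∣≤ : ∀ {x y z} → x ≤ z → y ≤ z → ℤ.∣ + x ℤ.- + y ∣ ≤ z
∣x-y∣≤ {x} {y} x≤z y≤z = ≤-trans (≤-reflexive (cong ℤ.∣_∣ (ℤ.m-n≡m⊖n x y))) (≤-trans (ℤ.∣m⊝n∣≤m⊔n x y) (⊔-lub x≤z y≤z))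

∣powers-powers∣≤ : ∀ {n H x y} → x ≤ H → y ≤ H → (j : Fin n) → ℤ.∣ powers (+ x) j ℤ.- powers (+ y) j ∣ ≤ H ^ suc (toℕ j)
∣powers-powers∣≤ {H = H} {x} {y} x≤ y≤ j =
  subst (λ z → ℤ.∣ z ∣ ≤ H ^ k) (cong₂ ℤ._-_ (pos-^ x k) (pos-^ y k)) (∣x-y∣≤ (^-monoˡ-≤ k x≤) (^-monoˡ-≤ k y≤))
  where k = suc (toℕ j)

-- The entry of `quadruple` with exponent j is at most 2 H^j in absolute value, and the further
-- factor d is the one that `short-relation` asks for, to leave room for d summands.
boxSize : ℕ → (d : ℕ) → Fin d → ℕ
boxSize H d j = d * 2 * H ^ suc (toℕ j)

module _ {m} .{{m≢0 : NonZero m}} {d} (a : Fin (suc d) → ℕ) where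

  -- The inner `% m` is kept because `imageSet` records reduced values, so this is the congruence of
  -- `energy` with f(x) and f(y) inserted.
  Solution : Fin m → Fin m → ℕ → ℕ → Set
  Solution z₁ z₂ x y = (toℕ z₁ + evalPoly a x % m) % m ≡ (toℕ z₂ + evalPoly a y % m) % m

  Solution? : ∀ z₁ z₂ x y → Dec (Solution z₁ z₂ x y)
  Solution? z₁ z₂ x y = (toℕ z₁ + evalPoly a x % m) % m ≟ (toℕ z₂ + evalPoly a y % m) % m

  quadruple : ℕ → ℕ → ℕ → ℕ → Fin d → ℤ
  quadruple x y x′ y′ j = (powers (+ x) j ℤ.- powers (+ y) j) ℤ.- (powers (+ x′) j ℤ.- powers (+ y′) j)

  dot-quadruple : ∀ c x y x′ y′ → dot c (quadruple x y x′ y′) ≡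
    (dot c (powers (+ x)) ℤ.- dot c (powers (+ y))) ℤ.- (dot c (powers (+ x′)) ℤ.- dot c (powers (+ y′)))
  dot-quadruple c x y x′ y′ = trans (dot-minus c (λ j → powers (+ x) j ℤ.- powers (+ y) j) (λ j → powers (+ x′) j ℤ.- powers (+ y′) j))
    (cong₂ ℤ._-_ (dot-minus c (powers (+ x)) (powers (+ y))) (dot-minus c (powers (+ x′)) (powers (+ y′))))

  ∣quadruple∣≤ : ∀ {H x y x′ y′} → x ≤ H → y ≤ H → x′ ≤ H → y′ ≤ H → ∀ j → ℤ.∣ quadruple x y x′ y′ j ∣ ≤ 2 * H ^ suc (toℕ j)
  ∣quadruple∣≤ {H} {x} {y} {x′} {y′} x≤ y≤ x′≤ y′≤ j = ≤-trans
    (ℤ.∣i-j∣≤∣i∣+∣j∣ (powers (+ x) j ℤ.- powers (+ y) j) (powers (+ x′) j ℤ.- powers (+ y′) j))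
    (≤-trans (+-mono-≤ (∣powers-powers∣≤ x≤ y≤ j) (∣powers-powers∣≤ x′≤ y′≤ j)) (≤-reflexive (cong (_+_ (H ^ k)) (sym (+-identityʳ (H ^ k))))))
    where k = suc (toℕ j)

  solution⇒∣ : ∀ {z₁ z₂ x y} → Solution z₁ z₂ x y → + m ∣ℤ (+ toℕ z₁ ℤ.+ + evalPoly a x) ℤ.- (+ toℕ z₂ ℤ.+ + evalPoly a y)
  solution⇒∣ {z₁} {z₂} {x} {y} sol = subst (+ m ∣ℤ_)
    (trans (cong₂ (λ u v → (u ℤ.- v) ℤ.- ((+ (f x % m) ℤ.- + f x) ℤ.- (+ (f y % m) ℤ.- + f y))) (ℤ.pos-+ (toℕ z₁) _) (ℤ.pos-+ (toℕ z₂) _))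
      (regroup (+ toℕ z₁) (+ toℕ z₂) (+ (f x % m)) (+ (f y % m)) (+ f x) (+ f y)))
    (∣m∣n⇒∣m-n (≡%⇒∣- {x = toℕ z₁ + f x % m} {y = toℕ z₂ + f y % m} sol) (∣m∣n⇒∣m-n (%-congruent m (f x)) (%-congruent m (f y))))
    where
    f = evalPoly a
    regroup : ∀ z z′ r s u v → ((z ℤ.+ r) ℤ.- (z′ ℤ.+ s)) ℤ.- ((r ℤ.- u) ℤ.- (s ℤ.- v)) ≡ (z ℤ.+ u) ℤ.- (z′ ℤ.+ v)
    regroup = ℤ-Solver.solve-∀

  -- Subtracting two solutions with the same z₁ and z₂ removes z₁, z₂ and the constant coefficient
  -- of f.
  quadruple-congruence : ∀ {z₁ z₂ x y x′ y′} → Solution z₁ z₂ x y → Solution z₁ z₂ x′ y′ →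
                         + m ∣ℤ dot (+_ ∘ a ∘ suc) (quadruple x y x′ y′)
  quadruple-congruence {z₁} {z₂} {x} {y} {x′} {y′} sol sol′ = subst (+ m ∣ℤ_) eq (∣m∣n⇒∣m-n (solution⇒∣ sol) (solution⇒∣ sol′))
    where
    P : ℕ → ℤ
    P x = dot (+_ ∘ a ∘ suc) (powers (+ x))
    regroup : ∀ z z′ a₀ p q r s → ((z ℤ.+ (a₀ ℤ.+ p)) ℤ.- (z′ ℤ.+ (a₀ ℤ.+ q))) ℤ.- ((z ℤ.+ (a₀ ℤ.+ r)) ℤ.- (z′ ℤ.+ (a₀ ℤ.+ s))) ≡ (p ℤ.- q) ℤ.- (r ℤ.- s)
    regroup = ℤ-Solver.solve-∀
    pair : ∀ x y → (+ toℕ z₁ ℤ.+ + evalPoly a x) ℤ.- (+ toℕ z₂ ℤ.+ + evalPoly a y) ≡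
                   (+ toℕ z₁ ℤ.+ (+ a zero ℤ.+ P x)) ℤ.- (+ toℕ z₂ ℤ.+ (+ a zero ℤ.+ P y))
    pair x y = cong₂ (λ u v → (+ toℕ z₁ ℤ.+ u) ℤ.- (+ toℕ z₂ ℤ.+ v)) (evalPoly-dot a x) (evalPoly-dot a y)
    eq : ((+ toℕ z₁ ℤ.+ + evalPoly a x) ℤ.- (+ toℕ z₂ ℤ.+ + evalPoly a y)) ℤ.-
         ((+ toℕ z₁ ℤ.+ + evalPoly a x′) ℤ.- (+ toℕ z₂ ℤ.+ + evalPoly a y′)) ≡ dot (+_ ∘ a ∘ suc) (quadruple x y x′ y′)
    eq = trans (cong₂ ℤ._-_ (pair x y) (pair x′ y′))
           (trans (regroup (+ toℕ z₁) (+ toℕ z₂) (+ a zero) (P x) (P y) (P x′) (P y′)) (sym (dot-quadruple (+_ ∘ a ∘ suc) x y x′ y′)))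

val : ∀ {H} → Fin H → ℕ
val x = suc (toℕ x)

-- Elimination replaces the relation found by pigeonhole, whose entries may be
-- as large as m, by one whose entries are bounded in terms of H alone.
lifting : ∀ {m} .{{_ : NonZero m}} {n} (a : Fin (suc (suc n)) → ℕ) → Coprime m (a (fromℕ (suc n))) →
  ∀ H → 1 ≤ H → ∏ (boxSize H (suc n)) < m →
  ∃[ c ] (c (fromℕ n) ≢ 0ℤ × (∀ j → ℤ.∣ c j ∣ ≤ orthBound n (2 * H ^ suc n)) ×
    (∀ {z₁ z₂} {x y x′ y′ : Fin H} → Solution a z₁ z₂ (val x) (val y) → Solution a z₁ z₂ (val x′) (val y′) →
      dot c (powers (+ val x)) ℤ.- dot c (powers (+ val y)) ≡ dot c (powers (+ val x′)) ℤ.- dot c (powers (+ val y′))))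
lifting {m} {n} a m⊥a H H≥1 ∏<m =
  case short-relation m (a ∘ suc) (boxSize H d) m⊥a (λ j → *-mono-≤ (s≤s (z≤n {suc (n * 2)})) (H^≥1 (suc (toℕ j)))) ∏<m of λ where
    (c , c≢0 , orth) → case small-orthogonal searchI w (*-mono-≤ (s≤s (z≤n {1})) (H^≥1 d)) w≤ c c≢0 of λ where
      (c′ , c′≢0 , orth′ , bound) → c′ , c′≢0 , bound , λ {z₁} {z₂} {x} {y} {x′} {y′} sol sol′ →
        ℤ.i-j≡0⇒i≡j _ _ (trans (sym (dot-quadruple a c′ (val x) (val y) (val x′) (val y′)))
          (orth′ ((x , y) , (x′ , y′)) (orth (w ((x , y) , (x′ , y′))) (quadruple-congruence a sol sol′)
            (λ j → ≤-trans (*-monoʳ-≤ d (entry≤ ((x , y) , (x′ , y′)) j)) (≤-reflexive (sym (*-assoc d 2 (H ^ suc (toℕ j)))))))))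
  where
  d = suc n
  instance H≢0 = >-nonZero H≥1
  H^≥1 : ∀ k → 1 ≤ H ^ k
  H^≥1 k = m^n>0 H k
  I = (Fin H × Fin H) × (Fin H × Fin H)
  searchI : ∀ {P : I → Set} → (∀ i → Dec (P i)) → Dec (∃ P)
  searchI = search-× (search-× any? any?) (search-× any? any?)
  w : I → Fin d → ℤ
  w ((x , y) , (x′ , y′)) = quadruple a (val x) (val y) (val x′) (val y′)
  entry≤ : ∀ i j → ℤ.∣ w i j ∣ ≤ 2 * H ^ suc (toℕ j)
  entry≤ ((x , y) , (x′ , y′)) = ∣quadruple∣≤ a (toℕ<n x) (toℕ<n y) (toℕ<n x′) (toℕ<n y′)
  w≤ : ∀ i j → ℤ.∣ w i j ∣ ≤ 2 * H ^ d
  w≤ i j = ≤-trans (entry≤ i j) (*-monoʳ-≤ 2 (^-monoʳ-≤ H (toℕ<n j)))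

-- `coeff` and `expo` separate the constant from the power of H in `orthBound`: replacing B = b H^e
-- by 2B² turns b into 2b² and doubles e. Both depend on the degree alone once b and e do.
coeff : ℕ → ℕ → ℕ
coeff zero    b = 1
coeff (suc n) b = suc n * (b * coeff n (2 * (b * b)))

expo : ℕ → ℕ → ℕ
expo zero    e = 0
expo (suc n) e = e + expo n (e + e)

orthBound-power : ∀ n b H e → orthBound n (b * H ^ e) ≡ coeff n b * H ^ expo n e
orthBound-power zero    b H e = refl
orthBound-power (suc n) b H e = begin
  suc n * (b * h * orthBound n (2 * (b * h * (b * h))))               ≡⟨ cong (λ x → suc n * (b * h * orthBound n x)) square ⟩
  suc n * (b * h * orthBound n (2 * (b * b) * H ^ (e + e)))           ≡⟨ cong (λ x → suc n * (b * h * x)) (orthBound-power n (2 * (b * b)) H (e + e)) ⟩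
  suc n * (b * h * (coeff n (2 * (b * b)) * H ^ expo n (e + e)))      ≡⟨ regroup (suc n) b h _ _ ⟩
  suc n * (b * coeff n (2 * (b * b))) * (h * H ^ expo n (e + e))      ≡⟨ cong (suc n * (b * coeff n (2 * (b * b))) *_) (^-distribˡ-+-* H e _) ⟨
  coeff (suc n) b * H ^ expo (suc n) e                                ∎
  where
  open ≡-Reasoning
  h = H ^ e
  rearrange : ∀ b h → 2 * (b * h * (b * h)) ≡ 2 * (b * b) * (h * h)
  rearrange = ℕ-Solver.solve-∀
  square : 2 * (b * h * (b * h)) ≡ 2 * (b * b) * H ^ (e + e)
  square = trans (rearrange b h) (cong (2 * (b * b) *_) (sym (^-distribˡ-+-* H e e)))
  regroup : ∀ n b h x y → n * (b * h * (x * y)) ≡ n * (b * x) * (h * y)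
  regroup = ℕ-Solver.solve-∀

-- Counting solutions

sum-swap₁₃ : ∀ {p q r} (f : Fin p → Fin q → Fin r → ℕ) →
             ∑[ i < p ] ∑[ j < q ] ∑[ k < r ] f i j k ≡ ∑[ j < q ] ∑[ k < r ] ∑[ i < p ] f i j k
sum-swap₁₃ f = trans (∑-comm (λ i j → sum (f i j))) (sum-cong-≗ (λ j → ∑-comm (λ i k → f i j k)))

module _ {e l F} (F-poly : Poly (suc (suc e)) l F) (l≢0 : l ≢ 0ℤ) (H : ℕ) where

  point : Fin H → ℤ
  point x = + val x

  point-injective : ∀ {x y} → point x ≡ point y → x ≡ y
  point-injective eq = toℕ-injective (suc-injective (ℤ.+-injective eq))

  diff? : ∀ n x y → Dec (F (point x) ℤ.- F (point y) ≡ n)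
  diff? n x y = F (point x) ℤ.- F (point y) ℤ.≟ n

  diagonal-count : ∑[ x < H ] ∑[ y < H ] 𝟙 (diff? 0ℤ x y) ≤ H * suc (suc e)
  diagonal-count = sum-bound (λ x → ≤-trans
    (sum-mono (λ y → 𝟙-mono (diff? 0ℤ x y) (F (point y) ℤ.≟ F (point x)) (λ eq → sym (ℤ.i-j≡0⇒i≡j _ _ eq))))
    (fibre-bound point point-injective F-poly l≢0 (F (point x))))

  shift? : ∀ δ n y → Dec (F (point y ℤ.+ δ) ℤ.- F (point y) ≡ n)
  shift? δ n y = F (point y ℤ.+ δ) ℤ.- F (point y) ℤ.≟ n

  -- With d = e + 2, the difference polynomial has degree d - 1 ≥ 1 and leading coefficient d l, and
  -- the factor δ keeps it nonzero; so the value n is taken at most d - 1 times.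
  shift-count : ∀ {δ} → δ ≢ 0ℤ → ∀ n → ∑[ y < H ] 𝟙 (shift? δ n y) ≤ suc e
  shift-count {δ} δ≢0 n with difference F-poly δ
  ... | D , D-poly , diff = ≤-trans
    (sum-mono (λ y → 𝟙-mono (shift? δ n y) (δ ℤ.* D (point y) ℤ.≟ n) (trans (sym (diff (point y))))))
    (fibre-bound point point-injective (poly-scale δ D-poly) nonzero n)
    where
    nonzero : δ ℤ.* (+ suc (suc e) ℤ.* l) ≢ 0ℤ
    nonzero eq with ℤ.i*j≡0⇒i≡0∨j≡0 δ eq
    ... | inj₁ δ≡0 = δ≢0 δ≡0
    ... | inj₂ dl≡0 with ℤ.i*j≡0⇒i≡0∨j≡0 (+ suc (suc e)) dl≡0
    ...   | inj₁ ()
    ...   | inj₂ l≡0 = l≢0 l≡0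

  above? : ∀ (k : Fin H) n (x y : Fin H) → Dec (val x ≡ val y + val k × F (point y ℤ.+ point k) ℤ.- F (point y) ≡ n)
  above? k n x y = (val x ≟ val y + val k) ×-dec shift? (point k) n y

  above-count : ∀ k n → ∑[ y < H ] ∑[ x < H ] 𝟙 (above? k n x y) ≤ suc e
  above-count k n = ≤-trans (sum-mono column) (shift-count {point k} (λ ()) n)
    where
    column : ∀ y → ∑[ x < H ] 𝟙 (above? k n x y) ≤ 𝟙 (shift? (point k) n y)
    column y with shift? (point k) n y
    ... | yes p = sum-𝟙-unique {H} (λ x → (val x ≟ val y + val k) ×-dec yes p)
                    (λ (p , _) (q , _) → toℕ-injective (suc-injective (trans p (sym q))))
    ... | no ¬p = ≤-reflexive (sum-𝟙-empty {H} (λ x → (val x ≟ val y + val k) ×-dec no ¬p) (λ x (_ , p) → ¬p p))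

  -- F(x) - F(y) = n forces x - y to divide n, and each value of x - y occurs at most d - 1 times.
  level-count : ∀ {n} → n ≢ 0ℤ → ∑[ x < H ] ∑[ y < H ] 𝟙 (diff? n x y) ≤ τ H ℤ.∣ n ∣ * (suc e + suc e)
  level-count {n} n≢0 = begin
    ∑[ x < H ] ∑[ y < H ] 𝟙 (diff? n x y)
      ≤⟨ sum-mono (λ x → sum-mono (cover x)) ⟩
    ∑[ x < H ] ∑[ y < H ] ∑[ k < H ] (α k * β k x y)
      ≡⟨ sum-cong-≗ (λ x → ∑-comm (λ y k → α k * β k x y)) ⟩
    ∑[ x < H ] ∑[ k < H ] ∑[ y < H ] (α k * β k x y)
      ≡⟨ ∑-comm (λ x k → ∑[ y < H ] (α k * β k x y)) ⟩
    ∑[ k < H ] ∑[ x < H ] ∑[ y < H ] (α k * β k x y)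
      ≤⟨ sum-mono per-divisor ⟩
    ∑[ k < H ] (α k * (suc e + suc e))
      ≡⟨ *-distribʳ-sum (suc e + suc e) α ⟨
    τ H ℤ.∣ n ∣ * (suc e + suc e) ∎
    where
    open ≤-Reasoning
    α : Fin H → ℕ
    α k = 𝟙 (val k ∣? ℤ.∣ n ∣)
    -- The divisor k is x - y or y - x; in the second case the roles of x and y are exchanged and n
    -- becomes -n. The two signs account for the bound 2(d - 1) per divisor.
    β : Fin H → Fin H → Fin H → ℕ
    β k x y = 𝟙 (above? k n x y) + 𝟙 (above? k (ℤ.- n) y x)
    per-divisor : ∀ k → ∑[ x < H ] ∑[ y < H ] (α k * β k x y) ≤ α k * (suc e + suc e)
    per-divisor k = begin
      ∑[ x < H ] ∑[ y < H ] (α k * β k x y)   ≡⟨ sum-cong-≗ (λ x → *-distribˡ-sum (α k) (β k x)) ⟨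
      ∑[ x < H ] (α k * sum (β k x))          ≡⟨ *-distribˡ-sum (α k) (λ x → sum (β k x)) ⟨
      α k * (∑[ x < H ] sum (β k x))
        ≡⟨ cong (α k *_) (trans (sum-cong-≗ (λ x → ∑-distrib-+ (λ y → 𝟙 (above? k n x y)) _)) (∑-distrib-+ (λ x → ∑[ y < H ] 𝟙 (above? k n x y)) _)) ⟩
      α k * (∑[ x < H ] (∑[ y < H ] 𝟙 (above? k n x y)) + ∑[ x < H ] (∑[ y < H ] 𝟙 (above? k (ℤ.- n) y x)))
        ≤⟨ *-monoʳ-≤ (α k) (+-mono-≤ (≤-trans (≤-reflexive (∑-comm (λ x y → 𝟙 (above? k n x y)))) (above-count k n)) (above-count k (ℤ.- n))) ⟩
      α k * (suc e + suc e)                   ∎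
    swap : ∀ u v → v ℤ.- u ≡ ℤ.- (u ℤ.- v)
    swap = ℤ-Solver.solve-∀
    gap : ∀ {u v : Fin H} → val v < val u → ∃[ k ] val u ≡ val v + val {H} k
    gap {u} {v} v<u = case positive-index {H} {val u ∸ val v} (m<n⇒0<n∸m v<u) (≤-trans (m∸n≤m (val u) (val v)) (toℕ<n u)) of λ where
      (k , eq) → k , sym (trans (cong (_+_ (val v)) eq) (m+[n∸m]≡n (<⇒≤ v<u)))
    gap-divides : ∀ {u v k n} → val u ≡ val v + val {H} k → F (point u) ℤ.- F (point v) ≡ n → val k ∣ℕ ℤ.∣ n ∣
    gap-divides {u} {v} {k} {n} u≡v+k eq with quotient F-poly (point v)
    ... | q , _ , quot = ∣⇒∣ᵤ (divides {point k} {n} (q (point u)) (trans (sym eq) (trans (quot (point u))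
            (trans (cong (λ z → (z ℤ.- point v) ℤ.* q (point u)) (trans (cong +_ u≡v+k) (ℤ.pos-+ (val v) (val k)))) (cancel (point v) (point k) (q (point u)))))))
      where
      cancel : ∀ v k q → ((v ℤ.+ k) ℤ.- v) ℤ.* q ≡ q ℤ.* k
      cancel = ℤ-Solver.solve-∀
    shifted : ∀ {u v k n} → val u ≡ val v + val {H} k → F (point u) ℤ.- F (point v) ≡ n → F (point v ℤ.+ point k) ℤ.- F (point v) ≡ n
    shifted {u} {v} {k} u≡v+k eq = trans (cong (λ z → F z ℤ.- F (point v)) (trans (sym (ℤ.pos-+ (val v) (val k))) (cong +_ (sym u≡v+k)))) eq
    single : ∀ k {x y} → 1 ≤ α k → 1 ≤ β k x y → 1 ≤ ∑[ k < H ] (α k * β k x y)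
    single k {x} {y} α≥1 β≥1 = ≤-trans (*-mono-≤ α≥1 β≥1) (term≤sum (λ k → α k * β k x y) k)
    cover : ∀ x y → 𝟙 (diff? n x y) ≤ ∑[ k < H ] (α k * β k x y)
    cover x y = 𝟙≤ (diff? n x y) λ eq → case <-cmp (val x) (val y) of λ where
      (tri≈ _ x≡y _) → contradiction (trans (sym eq) (ℤ.i≡j⇒i-j≡0 (cong (λ z → F (+ z)) x≡y))) n≢0
      (tri> _ _ y<x) → case gap {x} {y} y<x of λ where
        (k , x≡y+k) → single k {x} {y} (𝟙-yes (val k ∣? ℤ.∣ n ∣) (gap-divides {x} {y} {k} x≡y+k eq))
          (≤-trans (𝟙-yes (above? k n x y) (x≡y+k , shifted {x} {y} {k} x≡y+k eq)) (m≤m+n _ _))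
      (tri< x<y _ _) → case gap {y} {x} x<y of λ where
        (k , y≡x+k) → let eq′ = trans (swap (F (point x)) (F (point y))) (cong ℤ.-_ eq) in
          single k {x} {y} (𝟙-yes (val k ∣? ℤ.∣ n ∣) (subst (val k ∣ℕ_) (ℤ.∣-i∣≡∣i∣ n) (gap-divides {y} {x} {k} y≡x+k eq′)))
            (≤-trans (𝟙-yes (above? k (ℤ.- n) y x) (y≡x+k , shifted {y} {x} {k} y≡x+k eq′)) (m≤n+m _ _))

-- The integer part of the M-th root, found by descending from X, which is an upper bound as s ≤
-- s^M. It turns the bounds on τ^M into one natural number that bounds τ.
root : ∀ M .{{_ : NonZero M}} X → ∃[ r ] (r ^ M ≤ X × (∀ s → s ^ M ≤ X → s ≤ r))
root M X = descend X (λ s sᴹ≤X → ≤-trans (s≤s^M s M) sᴹ≤X)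
  where
  s≤s^M : ∀ s M .{{_ : NonZero M}} → s ≤ s ^ M
  s≤s^M zero    M       = z≤n
  s≤s^M s@(suc _) (suc M) = m≤m*n s (s ^ M) {{>-nonZero (m^n>0 s M)}}
  descend : ∀ r → (∀ s → s ^ M ≤ X → s ≤ r) → ∃[ r ] (r ^ M ≤ X × (∀ s → s ^ M ≤ X → s ≤ r))
  descend r upper with r ^ M ≤? X
  ... | yes rᴹ≤X = r , rᴹ≤X , upper
  descend zero    upper | no 0ᴹ≰X = contradiction (≤-trans (≤-reflexive (0^M M)) z≤n) 0ᴹ≰X
    where
    0^M : ∀ M .{{_ : NonZero M}} → 0 ^ M ≡ 0
    0^M (suc M) = refl
  descend (suc r) upper | no rᴹ≰X = descend r (λ s sᴹ≤X → m<1+n⇒m≤n (≤∧≢⇒< (upper s sᴹ≤X) (λ { refl → rᴹ≰X sᴹ≤X })))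

-- The energy as a count of solutions in x and y

𝟙*-mono : ∀ {P : Set} (P? : Dec P) {x y} → (P → x ≤ y) → 𝟙 P? * x ≤ 𝟙 P? * y
𝟙*-mono (yes p) x≤y = *-monoʳ-≤ 1 (x≤y p)
𝟙*-mono (no _)  x≤y = z≤n

-- Passage from image values to arguments. A value attained several times counts once on the left
-- and several times on the right, and `g′` has to dominate `g` only where b is the value at x.
image-sum : ∀ {m H} {β : Fin m → ℕ} {f : Fin H → ℕ} → (∀ b → β b ≤ ∑[ x < H ] 𝟙 (toℕ b ≟ f x)) →
  (g : Fin m → ℕ) (g′ : Fin H → ℕ) → (∀ b x → toℕ b ≡ f x → g b ≤ g′ x) → ∑[ b < m ] (β b * g b) ≤ sum g′
image-sum {m} {H} {β} {f} β≤ g g′ g≤g′ = begin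
  ∑[ b < m ] (β b * g b)
    ≤⟨ sum-mono (λ b → *-monoˡ-≤ (g b) (β≤ b)) ⟩
  ∑[ b < m ] ((∑[ x < H ] 𝟙 (toℕ b ≟ f x)) * g b)
    ≡⟨ sum-cong-≗ (λ b → *-distribʳ-sum (g b) (λ x → 𝟙 (toℕ b ≟ f x))) ⟩
  ∑[ b < m ] ∑[ x < H ] (𝟙 (toℕ b ≟ f x) * g b)
    ≤⟨ sum-mono (λ b → sum-mono (λ x → restrict b x)) ⟩
  ∑[ b < m ] ∑[ x < H ] (𝟙 (toℕ b ≟ f x) * g′ x)
    ≡⟨ ∑-comm {m} (λ b x → 𝟙 (toℕ b ≟ f x) * g′ x) ⟩
  ∑[ x < H ] ∑[ b < m ] (𝟙 (toℕ b ≟ f x) * g′ x)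
    ≡⟨ sum-cong-≗ (λ x → sym (*-distribʳ-sum (g′ x) (λ (b : Fin m) → 𝟙 (toℕ b ≟ f x)))) ⟩
  ∑[ x < H ] ((∑[ b < m ] 𝟙 (toℕ b ≟ f x)) * g′ x)
    ≤⟨ sum-mono (λ x → ≤-trans (*-monoˡ-≤ (g′ x) (sum-𝟙-unique {m} (λ b → toℕ b ≟ f x) (λ p q → toℕ-injective (trans p (sym q)))))
                               (≤-reflexive (+-identityʳ (g′ x)))) ⟩
  sum g′ ∎
  where
  open ≤-Reasoning
  restrict : ∀ b x → 𝟙 (toℕ b ≟ f x) * g b ≤ 𝟙 (toℕ b ≟ f x) * g′ x
  restrict b x = 𝟙*-mono (toℕ b ≟ f x) (g≤g′ b x)

ind-∧ : ∀ a b → ind (a ∧ b) ≡ ind a * ind b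
ind-∧ true  b = sym (+-identityʳ (ind b))
ind-∧ false b = refl

size : ∀ {n} (p : Subset n) → ∑[ i < n ] ind (lookup p i) ≡ ∣ p ∣
size []          = refl
size (true ∷ p)  = cong suc (size p)
size (false ∷ p) = size p

imageSet-indicator : ∀ {d} m .{{_ : NonZero m}} (a : Fin (suc d) → ℕ) H b →
  ind (lookup (imageSet m a H) b) ≤ ∑[ x < H ] 𝟙 (toℕ b ≟ evalPoly a (val x) % m)
imageSet-indicator m a H b = ≤-trans
  (≤-reflexive (cong ind (lookup∘tabulate (λ y → List.foldr _∨_ false (map (λ u → toℕ y ≡ᵇ (evalPoly a (suc u) % m)) (List.upTo H))) b)))
  (ind-any (λ u → toℕ b ≡ᵇ (evalPoly a (suc u) % m)) (λ u → u) H)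
  where
  ind-any : ∀ (g : ℕ → Bool) (h : ℕ → ℕ) H →
            ind (List.foldr _∨_ false (map g (List.applyUpTo h H))) ≤ ∑[ x < H ] ind (g (h (toℕ x)))
  ind-any g h zero = z≤n
  ind-any g h (suc H) with g (h 0)
  ... | true  = s≤s z≤n
  ... | false = ind-any g (h ∘ suc) H

+-%-injective : ∀ {m} .{{_ : NonZero m}} (i j : Fin m) c → (toℕ i + c) % m ≡ (toℕ j + c) % m → i ≡ j
+-%-injective {m} i j c eq = toℕ-injective (ℤ.+-injective (ℤ.i-j≡0⇒i≡j _ _
  (m∣i∧∣i∣<m⇒i≡0 (subst (+ m ∣ℤ_) (trans (cong₂ ℤ._-_ (ℤ.pos-+ (toℕ i) c) (ℤ.pos-+ (toℕ j) c)) (cancel (+ toℕ i) (+ toℕ j) (+ c)))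
                                  (≡%⇒∣- {x = toℕ i + c} {y = toℕ j + c} eq))
                 (≤-<-trans (∣x-y∣≤ (<⇒≤pred (toℕ<n i)) (<⇒≤pred (toℕ<n j))) (≤-reflexive (suc-pred m))))))
  where
  cancel : ∀ i j c → (i ℤ.+ c) ℤ.- (j ℤ.+ c) ≡ i ℤ.- j
  cancel = ℤ-Solver.solve-∀

module _ {m} .{{m≢0 : NonZero m}} {d} (a : Fin (suc d) → ℕ) (H : ℕ) (𝒵 : Subset m) where

  Z : ℕ
  Z = ∣ 𝒵 ∣

  α β : Fin m → ℕ
  α z = ind (lookup 𝒵 z)
  β b = ind (lookup (imageSet m a H) b)

  θ : Fin m → Fin m → Fin m → Fin m → ℕ
  θ z₁ z₂ b₁ b₂ = 𝟙 ((toℕ z₁ + toℕ b₁) % m ≟ (toℕ z₂ + toℕ b₂) % m)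

  fibre : Fin m → Fin m → ℕ
  fibre z₁ z₂ = ∑[ b₁ < m ] (β b₁ * ∑[ b₂ < m ] (β b₂ * θ z₁ z₂ b₁ b₂))

  energy-fibres : energy m 𝒵 (imageSet m a H) ≡ ∑[ z₁ < m ] (α z₁ * ∑[ z₂ < m ] (α z₂ * fibre z₁ z₂))
  energy-fibres = list⇒sum (λ z₁ → trans (list⇒sum (λ z₂ → trans (list⇒sum (λ b₁ → trans (list⇒sum (λ b₂ →
        expand (lookup 𝒵 z₁) (lookup 𝒵 z₂) (lookup B b₁) (lookup B b₂) _))
      (pull₃ (α z₁) (α z₂) (β b₁) (λ b₂ → β b₂ * θ z₁ z₂ b₁ b₂))))
      (pull₂ (α z₁) (α z₂) (λ b₁ → β b₁ * ∑[ b₂ < m ] (β b₂ * θ z₁ z₂ b₁ b₂)))))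
      (pull (α z₁) (λ z₂ → α z₂ * fibre z₁ z₂)))
    where
    B = imageSet m a H
    list⇒sum : ∀ {n} {f g : Fin n → ℕ} → (∀ i → f i ≡ g i) → Σfin f ≡ sum g
    list⇒sum {f = f} f≡g = trans (list-sum f) (sum-cong-≗ f≡g)
    expand : ∀ p q r s t → ind (p ∧ q ∧ r ∧ s ∧ t) ≡ ind p * (ind q * (ind r * (ind s * ind t)))
    expand p q r s t = trans (ind-∧ p _) (cong (ind p *_) (trans (ind-∧ q _) (cong (ind q *_) (trans (ind-∧ r _) (cong (ind r *_) (ind-∧ s t))))))
    pull : ∀ {n} x (g : Fin n → ℕ) → ∑[ i < n ] (x * g i) ≡ x * sum g
    pull x g = sym (*-distribˡ-sum x g)
    pull₂ : ∀ {n} x y (g : Fin n → ℕ) → ∑[ i < n ] (x * (y * g i)) ≡ x * (y * sum g)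
    pull₂ x y g = trans (pull x (λ i → y * g i)) (cong (x *_) (pull y g))
    pull₃ : ∀ {n} x y z (g : Fin n → ℕ) → ∑[ i < n ] (x * (y * (z * g i))) ≡ x * (y * (z * sum g))
    pull₃ x y z g = trans (pull x (λ i → y * (z * g i))) (cong (x *_) (pull₂ y z g))

  weighted-bound : ∀ {g : Fin m → ℕ} {c} → (∀ z → g z ≤ c) → ∑[ z < m ] (α z * g z) ≤ Z * c
  weighted-bound {g} {c} g≤c = begin
    ∑[ z < m ] (α z * g z)   ≤⟨ sum-mono (λ z → *-monoʳ-≤ (α z) (g≤c z)) ⟩
    ∑[ z < m ] (α z * c)     ≡⟨ *-distribʳ-sum c α ⟨
    sum α * c                ≡⟨ cong (_* c) (size 𝒵) ⟩
    Z * c                    ∎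
    where open ≤-Reasoning

  -- There are at most H values b₁, and z₁, z₂, b₁ determine the residue b₂.
  fibre≤H : ∀ z₁ z₂ → fibre z₁ z₂ ≤ H
  fibre≤H z₁ z₂ = ≤-trans
    (image-sum {H = H} {f = λ x → evalPoly a (val x) % m} (imageSet-indicator m a H) (λ b₁ → ∑[ b₂ < m ] (β b₂ * θ z₁ z₂ b₁ b₂)) (λ _ → 1) (λ b₁ _ _ → ≤-trans
      (sum-mono (λ b₂ → ≤-trans (*-monoˡ-≤ (θ z₁ z₂ b₁ b₂) (β≤1 b₂)) (≤-reflexive (+-identityʳ _))))
      (sum-𝟙-unique (λ b₂ → (toℕ z₁ + toℕ b₁) % m ≟ (toℕ z₂ + toℕ b₂) % m)
        (λ {b} {b′} p q → +-%-injective b b′ (toℕ z₂)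
          (trans (cong (_% m) (+-comm (toℕ b) (toℕ z₂))) (trans (trans (sym p) q) (cong (_% m) (+-comm (toℕ z₂) (toℕ b′)))))))))
    (≤-trans (sum-bound {H} {λ _ → 1} (λ _ → ≤-refl)) (≤-reflexive (*-identityʳ H)))
    where
    β≤1 : ∀ b → β b ≤ 1
    β≤1 b with lookup (imageSet m a H) b
    ... | true  = ≤-refl
    ... | false = z≤n

  fibre≤solutions : ∀ z₁ z₂ → fibre z₁ z₂ ≤ ∑[ x < H ] ∑[ y < H ] 𝟙 (Solution? a z₁ z₂ (val x) (val y))
  fibre≤solutions z₁ z₂ = image-sum {H = H} {f = λ x → evalPoly a (val x) % m} (imageSet-indicator m a H) _ (λ x → ∑[ y < H ] 𝟙 (Solution? a z₁ z₂ (val x) (val y)))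
    (λ b₁ x b₁≡fx → image-sum {H = H} {f = λ x → evalPoly a (val x) % m} (imageSet-indicator m a H) _ (λ y → 𝟙 (Solution? a z₁ z₂ (val x) (val y)))
      (λ b₂ y b₂≡fy → 𝟙-mono ((toℕ z₁ + toℕ b₁) % m ≟ (toℕ z₂ + toℕ b₂) % m) (Solution? a z₁ z₂ (val x) (val y))
        (λ eq → trans (cong (λ b → (toℕ z₁ + b) % m) (sym b₁≡fx)) (trans eq (cong (λ b → (toℕ z₂ + b) % m) b₂≡fy)))))

  trivial-bound : energy m 𝒵 (imageSet m a H) ≤ Z * (Z * H)
  trivial-bound = ≤-trans (≤-reflexive energy-fibres) (weighted-bound (λ z₁ → weighted-bound (λ z₂ → fibre≤H z₁ z₂)))

  module _ {e l F} (F-poly : Poly (suc (suc e)) l F) (l≢0 : l ≢ 0ℤ)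
           (lifts : ∀ {z₁ z₂} {x y x′ y′ : Fin H} → Solution a z₁ z₂ (val x) (val y) → Solution a z₁ z₂ (val x′) (val y′) →
                    F (+ val x) ℤ.- F (+ val y) ≡ F (+ val x′) ℤ.- F (+ val y′))
           {t} (τ≤t : ∀ (x y : Fin H) → F (+ val x) ℤ.- F (+ val y) ≢ 0ℤ → τ H ℤ.∣ F (+ val x) ℤ.- F (+ val y) ∣ ≤ t) where

    diagonal? : ∀ z₁ z₂ x y → Dec (Solution a z₁ z₂ (val x) (val y) × F (+ val {H} x) ℤ.- F (+ val {H} y) ≡ 0ℤ)
    diagonal? z₁ z₂ x y = Solution? a z₁ z₂ (val x) (val y) ×-dec diff? F-poly l≢0 H 0ℤ x y

    generic? : ∀ z₁ z₂ x y → Dec (Solution a z₁ z₂ (val x) (val y) × F (+ val {H} x) ℤ.- F (+ val {H} y) ≢ 0ℤ)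
    generic? z₁ z₂ x y = Solution? a z₁ z₂ (val x) (val y) ×-dec ¬? (diff? F-poly l≢0 H 0ℤ x y)

    diagonal generic : Fin m → Fin m → ℕ
    diagonal z₁ z₂ = ∑[ x < H ] ∑[ y < H ] 𝟙 (diagonal? z₁ z₂ x y)
    generic  z₁ z₂ = ∑[ x < H ] ∑[ y < H ] 𝟙 (generic? z₁ z₂ x y)

    fibre≤diagonal+generic : ∀ z₁ z₂ → fibre z₁ z₂ ≤ diagonal z₁ z₂ + generic z₁ z₂
    fibre≤diagonal+generic z₁ z₂ = begin
      fibre z₁ z₂
        ≤⟨ fibre≤solutions z₁ z₂ ⟩
      ∑[ x < H ] ∑[ y < H ] 𝟙 (Solution? a z₁ z₂ (val x) (val y))
        ≤⟨ sum-mono (λ x → sum-mono (λ y → 𝟙≤ (Solution? a z₁ z₂ (val x) (val y)) (split x y))) ⟩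
      ∑[ x < H ] ∑[ y < H ] (𝟙 (diagonal? z₁ z₂ x y) + 𝟙 (generic? z₁ z₂ x y))
        ≡⟨ sum-cong-≗ (λ x → ∑-distrib-+ (λ y → 𝟙 (diagonal? z₁ z₂ x y)) (λ y → 𝟙 (generic? z₁ z₂ x y))) ⟩
      ∑[ x < H ] (∑[ y < H ] 𝟙 (diagonal? z₁ z₂ x y) + ∑[ y < H ] 𝟙 (generic? z₁ z₂ x y))
        ≡⟨ ∑-distrib-+ (λ x → ∑[ y < H ] 𝟙 (diagonal? z₁ z₂ x y)) (λ x → ∑[ y < H ] 𝟙 (generic? z₁ z₂ x y)) ⟩
      diagonal z₁ z₂ + generic z₁ z₂ ∎
      where
      open ≤-Reasoning
      split : ∀ x y → Solution a z₁ z₂ (val x) (val y) → 1 ≤ 𝟙 (diagonal? z₁ z₂ x y) + 𝟙 (generic? z₁ z₂ x y)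
      split x y sol = case diff? F-poly l≢0 H 0ℤ x y of λ where
        (yes eq) → ≤-trans (𝟙-yes (diagonal? z₁ z₂ x y) (sol , eq)) (m≤m+n _ _)
        (no neq) → ≤-trans (𝟙-yes (generic? z₁ z₂ x y) (sol , neq)) (m≤n+m _ _)

    -- The sum over z₂ is moved inside, where z₁, x and y leave at most one choice. The pairs with
    -- F(x) = F(y) thus cost d H for each z₁, not for each (z₁, z₂), which yields Z H instead of Z²
    -- H.
    diagonal-total : ∀ z₁ → ∑[ z₂ < m ] diagonal z₁ z₂ ≤ H * suc (suc e)
    diagonal-total z₁ = begin
      ∑[ z₂ < m ] diagonal z₁ z₂
        ≡⟨ sum-swap₁₃ (λ z₂ x y → 𝟙 (diagonal? z₁ z₂ x y)) ⟩
      ∑[ x < H ] ∑[ y < H ] ∑[ z₂ < m ] 𝟙 (diagonal? z₁ z₂ x y)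
        ≤⟨ sum-mono (λ x → sum-mono (λ y → forget x y)) ⟩
      ∑[ x < H ] ∑[ y < H ] 𝟙 (diff? F-poly l≢0 H 0ℤ x y)
        ≤⟨ diagonal-count F-poly l≢0 H ⟩
      H * suc (suc e) ∎
      where
      open ≤-Reasoning
      forget : ∀ x y → ∑[ z₂ < m ] 𝟙 (diagonal? z₁ z₂ x y) ≤ 𝟙 (diff? F-poly l≢0 H 0ℤ x y)
      forget x y with diff? F-poly l≢0 H 0ℤ x y
      ... | yes p = sum-𝟙-unique {m} (λ z₂ → Solution? a z₁ z₂ (val x) (val y) ×-dec yes p)
                      (λ {z} {z′} (p , _) (q , _) → +-%-injective z z′ (evalPoly a (val y) % m) (trans (sym p) q))
      ... | no ¬p = ≤-reflexive (sum-𝟙-empty {m} (λ z₂ → Solution? a z₁ z₂ (val x) (val y) ×-dec no ¬p) (λ _ (_ , p) → ¬p p))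

    generic-bound : ∀ z₁ z₂ → generic z₁ z₂ ≤ t * (suc e + suc e)
    generic-bound z₁ z₂ with any? (λ x → any? (λ y → generic? z₁ z₂ x y))
    ... | no none = ≤-trans (sum-bound (λ x → ≤-reflexive (sum-𝟙-empty (generic? z₁ z₂ x) (λ y p → none (x , y , p)))))
                      (≤-trans (≤-reflexive (*-zeroʳ H)) z≤n)
    -- A single generic solution fixes n, and `lifts` places all the others on the same level set.
    ... | yes (x₀ , y₀ , sol₀ , n≢0) = begin
      generic z₁ z₂
        ≤⟨ sum-mono (λ x → sum-mono (λ y → 𝟙-mono (generic? z₁ z₂ x y) (diff? F-poly l≢0 H n x y) (λ (sol , _) → lifts sol sol₀))) ⟩
      ∑[ x < H ] ∑[ y < H ] 𝟙 (diff? F-poly l≢0 H n x y)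
        ≤⟨ level-count F-poly l≢0 H n≢0 ⟩
      τ H ℤ.∣ n ∣ * (suc e + suc e)
        ≤⟨ *-monoˡ-≤ (suc e + suc e) (τ≤t x₀ y₀ n≢0) ⟩
      t * (suc e + suc e) ∎
      where
      open ≤-Reasoning
      n = F (+ val x₀) ℤ.- F (+ val y₀)

    structured-bound : energy m 𝒵 (imageSet m a H) ≤ Z * (H * suc (suc e) + Z * (t * (suc e + suc e)))
    structured-bound = ≤-trans (≤-reflexive energy-fibres) (weighted-bound λ z₁ → begin
      ∑[ z₂ < m ] (α z₂ * fibre z₁ z₂)
        ≤⟨ sum-mono (λ z₂ → separate z₁ z₂) ⟩
      ∑[ z₂ < m ] (diagonal z₁ z₂ + α z₂ * generic z₁ z₂)
        ≡⟨ ∑-distrib-+ (diagonal z₁) (λ z₂ → α z₂ * generic z₁ z₂) ⟩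
      ∑[ z₂ < m ] diagonal z₁ z₂ + ∑[ z₂ < m ] (α z₂ * generic z₁ z₂)
        ≤⟨ +-mono-≤ (diagonal-total z₁) (weighted-bound (generic-bound z₁)) ⟩
      H * suc (suc e) + Z * (t * (suc e + suc e)) ∎)
      where
      open ≤-Reasoning
      α≤1 : ∀ z → α z ≤ 1
      α≤1 z with lookup 𝒵 z
      ... | true  = ≤-refl
      ... | false = z≤n
      -- The weight of z₂ is bounded by 1 on the diagonal part, which `diagonal-total` sums over all
      -- residues z₂; on the generic part it is kept, to produce the factor Z.
      separate : ∀ z₁ z₂ → α z₂ * fibre z₁ z₂ ≤ diagonal z₁ z₂ + α z₂ * generic z₁ z₂
      separate z₁ z₂ = begin
        α z₂ * fibre z₁ z₂                                    ≤⟨ *-monoʳ-≤ (α z₂) (fibre≤diagonal+generic z₁ z₂) ⟩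
        α z₂ * (diagonal z₁ z₂ + generic z₁ z₂)               ≡⟨ *-distribˡ-+ (α z₂) (diagonal z₁ z₂) (generic z₁ z₂) ⟩
        α z₂ * diagonal z₁ z₂ + α z₂ * generic z₁ z₂          ≤⟨ +-monoˡ-≤ _ (*-monoˡ-≤ (diagonal z₁ z₂) (α≤1 z₂)) ⟩
        1 * diagonal z₁ z₂ + α z₂ * generic z₁ z₂             ≡⟨ cong (_+ α z₂ * generic z₁ z₂) (*-identityˡ (diagonal z₁ z₂)) ⟩
        diagonal z₁ z₂ + α z₂ * generic z₁ z₂                 ∎

-- The two ranges of m

-- The sum k + (k + 1) + ... + (k + n - 1), which is d(d+1)/2 for k = 1 and n = d.
boxExponent : ℕ → ℕ → ℕ
boxExponent k zero    = 0
boxExponent k (suc n) = k + boxExponent (suc k) n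

∏-power : ∀ A H k n → ∏ {n} (λ j → A * H ^ (k + toℕ j)) ≡ A ^ n * H ^ boxExponent k n
∏-power A H k zero    = refl
∏-power A H k (suc n) = begin
  A * H ^ (k + 0) * ∏ {n} (λ j → A * H ^ (k + suc (toℕ j)))
    ≡⟨ cong₂ (λ x y → A * H ^ x * y) (+-identityʳ k) (∏-cong n (λ j → cong (λ x → A * H ^ x) (+-suc k (toℕ j)))) ⟩
  A * H ^ k * ∏ {n} (λ j → A * H ^ (suc k + toℕ j))
    ≡⟨ cong (A * H ^ k *_) (∏-power A H (suc k) n) ⟩
  A * H ^ k * (A ^ n * H ^ boxExponent (suc k) n)
    ≡⟨ swap A (H ^ k) (A ^ n) _ ⟩
  A * A ^ n * (H ^ k * H ^ boxExponent (suc k) n)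
    ≡⟨ cong (A * A ^ n *_) (^-distribˡ-+-* H k _) ⟨
  A ^ suc n * H ^ boxExponent k (suc n) ∎
  where
  open ≡-Reasoning
  swap : ∀ a h x y → a * h * (x * y) ≡ a * x * (h * y)
  swap = ℕ-Solver.solve-∀
  ∏-cong : ∀ n {f g : Fin n → ℕ} → (∀ j → f j ≡ g j) → ∏ f ≡ ∏ g
  ∏-cong zero    f≡g = refl
  ∏-cong (suc n) f≡g = cong₂ _*_ (f≡g zero) (∏-cong n (f≡g ∘ suc))

boxExponent-double : ∀ k n → boxExponent k n + boxExponent k n + n ≡ n * (2 * k + n)
boxExponent-double k zero    = refl
boxExponent-double k (suc n) = begin
  (k + b) + (k + b) + suc n               ≡⟨ regroup k b n ⟩
  b + b + n + (2 * k + 1)                 ≡⟨ cong (_+ (2 * k + 1)) (boxExponent-double (suc k) n) ⟩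
  n * (2 * suc k + n) + (2 * k + 1)       ≡⟨ expand k n ⟩
  suc n * (2 * k + suc n)                 ∎
  where
  open ≡-Reasoning
  b = boxExponent (suc k) n
  regroup : ∀ k b n → (k + b) + (k + b) + suc n ≡ b + b + n + (2 * k + 1)
  regroup = ℕ-Solver.solve-∀
  expand : ∀ k n → n * (2 * suc k + n) + (2 * k + 1) ≡ suc n * (2 * k + suc n)
  expand = ℕ-Solver.solve-∀

-- Squaring avoids the half in d(d+1)/2 and fits the m² in the hypothesis on `t`.
∏-boxSize-square : ∀ H d → ∏ (boxSize H d) * ∏ (boxSize H d) ≡ (d * 2) ^ (d + d) * H ^ (d * suc d)
∏-boxSize-square H d = begin
  ∏ (boxSize H d) * ∏ (boxSize H d)       ≡⟨ cong (λ x → x * x) (∏-power A H 1 d) ⟩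
  A ^ d * H ^ b * (A ^ d * H ^ b)         ≡⟨ swap (A ^ d) (H ^ b) ⟩
  A ^ d * A ^ d * (H ^ b * H ^ b)         ≡⟨ cong₂ _*_ (^-distribˡ-+-* A d d) (^-distribˡ-+-* H b b) ⟨
  A ^ (d + d) * H ^ (b + b)               ≡⟨ cong (λ x → A ^ (d + d) * H ^ x) exponent ⟩
  A ^ (d + d) * H ^ (d * suc d)           ∎
  where
  open ≡-Reasoning
  A = d * 2
  b = boxExponent 1 d
  swap : ∀ x y → x * y * (x * y) ≡ x * x * (y * y)
  swap = ℕ-Solver.solve-∀
  expand : ∀ d → d * (2 * 1 + d) ≡ d * suc d + d
  expand = ℕ-Solver.solve-∀
  exponent : b + b ≡ d * suc d
  exponent = +-cancelʳ-≡ d (b + b) (d * suc d) (trans (boxExponent-double 1 d) (expand d))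

value-bound : ∀ {n H B} → .{{NonZero H}} → (c : Fin n → ℤ) → (∀ j → ℤ.∣ c j ∣ ≤ B) → ∀ (x y : Fin H) →
  ℤ.∣ dot c (powers (+ val x)) ℤ.- dot c (powers (+ val y)) ∣ ≤ n * (B * H ^ n)
value-bound {n} {H} {B} c c≤ x y = begin
  ℤ.∣ dot c (powers (+ val x)) ℤ.- dot c (powers (+ val y)) ∣
    ≡⟨ cong ℤ.∣_∣ (dot-minus c (powers (+ val x)) (powers (+ val y))) ⟨
  ℤ.∣ dot c w ∣
    ≤⟨ ∣dot∣≤ c w ⟩
  sum (λ j → ℤ.∣ c j ∣ * ℤ.∣ w j ∣)
    ≤⟨ sum-bound (λ j → *-mono-≤ (c≤ j) (≤-trans (∣powers-powers∣≤ (toℕ<n x) (toℕ<n y) j) (^-monoʳ-≤ H (toℕ<n j)))) ⟩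
  n * (B * H ^ n) ∎
  where
  open ≤-Reasoning
  w : Fin n → ℤ
  w j = powers (+ val x) j ℤ.- powers (+ val y) j

orthBound-value : ∀ k d H → d * (orthBound k (2 * H ^ d) * H ^ d) ≡ d * coeff k 2 * H ^ (expo k d + d)
orthBound-value k d H = begin
  d * (orthBound k (2 * H ^ d) * H ^ d)           ≡⟨ cong (λ z → d * (z * H ^ d)) (orthBound-power k 2 H d) ⟩
  d * (coeff k 2 * H ^ expo k d * H ^ d)          ≡⟨ regroup d (coeff k 2) (H ^ expo k d) (H ^ d) ⟩
  d * coeff k 2 * (H ^ expo k d * H ^ d)          ≡⟨ cong (d * coeff k 2 *_) (^-distribˡ-+-* H (expo k d) d) ⟨
  d * coeff k 2 * H ^ (expo k d + d)              ∎
  where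
  open ≡-Reasoning
  regroup : ∀ d k x y → d * (k * x * y) ≡ d * k * (x * y)
  regroup = ℕ-Solver.solve-∀

-- c is the coefficient vector of the polynomial F of the header.
Lifting : ℕ → ℕ → ℕ → Set
Lifting n Y K = ∀ {m} .{{_ : NonZero m}} (a : Fin (suc (suc n)) → ℕ) → Coprime m (a (fromℕ (suc n))) →
  ∀ H → 1 ≤ H → ∏ (boxSize H (suc n)) < m →
  ∃[ c ] (c (fromℕ n) ≢ 0ℤ ×
    (∀ (x y : Fin H) → ℤ.∣ dot c (powers (+ val x)) ℤ.- dot c (powers (+ val y)) ∣ ≤ Y * H ^ K) ×
    (∀ {z₁ z₂} {x y x′ y′ : Fin H} → Solution a z₁ z₂ (val x) (val y) → Solution a z₁ z₂ (val x′) (val y′) →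
      dot c (powers (+ val x)) ℤ.- dot c (powers (+ val y)) ≡ dot c (powers (+ val x′)) ℤ.- dot c (powers (+ val y′))))

lifting-exists : ∀ n → ∃[ Y ] ∃[ K ] (NonZero K × Lifting n Y K)
lifting-exists n = suc n * coeff n 2 , expo n (suc n) + suc n , >-nonZero (≤-trans (s≤s z≤n) (m≤n+m (suc n) (expo n (suc n)))) ,
  λ a m⊥a H H≥1 ∏<m → case lifting a m⊥a H H≥1 ∏<m of λ where
    (c , c≢0 , c≤ , lifts) → c , c≢0
      , (λ x y → ≤-trans (value-bound {{>-nonZero H≥1}} c c≤ x y) (≤-reflexive (orthBound-value n (suc n) H)))
      , (λ {z₁} {z₂} {x} {y} {x′} {y′} → lifts {z₁} {z₂} {x} {y} {x′} {y′})

-- Here t is the integer M-th root of a constant times H^K, by the divisor bound at |F(x) - F(y)| ≤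
-- Y H^K. So t is of order H^(K/M) at most, and M is still free.
large-modulus-bound : ∀ e {Y K} → Lifting (suc e) Y K → ∀ M → .{{NonZero M}} →
  ∃[ C ] (∀ m → .{{_ : NonZero m}} → (a : Fin (suc (suc (suc e))) → ℕ) → Coprime m (a (fromℕ (suc (suc e)))) →
    ∀ H → 1 ≤ H → ∏ (boxSize H (suc (suc e))) < m → (𝒵 : Subset m) →
    ∃[ t ] (t ^ M ≤ C * H ^ K ×
            energy m 𝒵 (imageSet m a H) ≤ ∣ 𝒵 ∣ * (H * suc (suc e) + ∣ 𝒵 ∣ * (t * (suc e + suc e)))))
large-modulus-bound e {Y} {K} lift M with divisor-bound M
... | C , τ-bound = C * Y , bound
  where
  bound : ∀ m → .{{_ : NonZero m}} → (a : Fin (suc (suc (suc e))) → ℕ) → Coprime m (a (fromℕ (suc (suc e)))) →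
    ∀ H → 1 ≤ H → ∏ (boxSize H (suc (suc e))) < m → (𝒵 : Subset m) →
    ∃[ t ] (t ^ M ≤ C * Y * H ^ K ×
            energy m 𝒵 (imageSet m a H) ≤ ∣ 𝒵 ∣ * (H * suc (suc e) + ∣ 𝒵 ∣ * (t * (suc e + suc e))))
  bound m a m⊥a H H≥1 ∏<m 𝒵 =
    let c , c≢0 , size , lifts = lift a m⊥a H H≥1 ∏<m
        t , tᴹ≤ , maximal = root M (C * Y * H ^ K)
    in t , tᴹ≤ ,
    structured-bound a H 𝒵 (poly-powers c) c≢0 (λ {z₁} {z₂} {x} {y} {x′} {y′} → lifts {z₁} {z₂} {x} {y} {x′} {y′})
      (λ x y n≢0 → maximal _ (≤-trans (τ-bound _ {{≢-nonZero (n≢0 ∘ ℤ.∣i∣≡0⇒i≡0)}} H)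
        (≤-trans (*-monoʳ-≤ C (size x y)) (≤-reflexive (sym (*-assoc C Y (H ^ K)))))))

-- Rational upper bounds in place of real powers

1≤ℚ : ∀ {H k s} → 1 ≤ H → 0ℚ ≤ℚ s → ℕ→ℚ H ≤ℚ (s ^ℚ suc k) → 1ℚ ≤ℚ s
1≤ℚ {H} {k} {s} H≥1 0≤s H≤ = ^ℚ-cancel-≤ 0≤s (suc k) (ℚ.≤-trans (ℚ.≤-reflexive (1^ℚ (suc k))) (ℚ.≤-trans (ℕ→ℚ-mono {1} {H} H≥1) H≤))

-- Raising H ≤ s^(k+1) to the power K gives H^K ≤ s^M with M = (k + 1) K, the exponent of T; then
-- M-th powers are cancelled.
root-bound-ℚ : ∀ {C H K k T s} → .{{NonZero K}} → 0ℚ ≤ℚ s → ℕ→ℚ H ≤ℚ (s ^ℚ suc k) → T ^ (suc k * K) ≤ C * H ^ K →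
               ℕ→ℚ T ≤ℚ ℕ→ℚ (suc C) *ℚ s
root-bound-ℚ {C} {H} {K} {k} {T} {s} 0≤s H≤ T≤ =
  ^ℚ-cancel-≤ (0≤*ℚ (0≤ℕ→ℚ (suc C)) 0≤s) M (begin
    ℕ→ℚ T ^ℚ M                         ≡⟨ ℕ→ℚ-^ T M ⟨
    ℕ→ℚ (T ^ M)                        ≤⟨ ℕ→ℚ-mono T≤ ⟩
    ℕ→ℚ (C * H ^ K)                    ≤⟨ ℕ→ℚ-mono (*-monoˡ-≤ (H ^ K) C≤) ⟩
    ℕ→ℚ (suc C ^ M * H ^ K)            ≡⟨ ℕ→ℚ-* (suc C ^ M) (H ^ K) ⟩
    ℕ→ℚ (suc C ^ M) *ℚ ℕ→ℚ (H ^ K)     ≤⟨ *ℚ-mono-≤ (0≤ℕ→ℚ (suc C ^ M)) (^ℚ-nonNeg 0≤s M) ℚ.≤-refl H^K≤ ⟩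
    ℕ→ℚ (suc C ^ M) *ℚ (s ^ℚ M)        ≡⟨ cong (_*ℚ (s ^ℚ M)) (ℕ→ℚ-^ (suc C) M) ⟩
    (ℕ→ℚ (suc C) ^ℚ M) *ℚ (s ^ℚ M)     ≡⟨ ^ℚ-distribʳ-* M (ℕ→ℚ (suc C)) s ⟨
    (ℕ→ℚ (suc C) *ℚ s) ^ℚ M            ∎)
  where
  open ℚ.≤-Reasoning
  M = suc k * K
  instance M≢0 = m*n≢0 (suc k) K
  -- The successor makes the base at least 1 even when C = 0, so its M-th power is at least the
  -- base.
  C≤ : C ≤ suc C ^ M
  C≤ = ≤-trans (n≤1+n C) (≤-trans (≤-reflexive (sym (^-identityʳ (suc C)))) (^-monoʳ-≤ (suc C) (>-nonZero⁻¹ M)))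
  H^K≤ : ℕ→ℚ (H ^ K) ≤ℚ (s ^ℚ M)
  H^K≤ = ℚ.≤-trans (ℚ.≤-reflexive (ℕ→ℚ-^ H K)) (ℚ.≤-trans (^ℚ-mono-≤ (0≤ℕ→ℚ H) H≤ K) (ℚ.≤-reflexive (^ℚ-* s (suc k) K)))

large-modulus-ℚ : ∀ {E Z H d w T S s} → 1ℚ ≤ℚ s → E ≤ Z * (H * d + Z * (T * w)) → ℕ→ℚ T ≤ℚ ℕ→ℚ S *ℚ s →
                  ℕ→ℚ E ≤ℚ (ℕ→ℚ (d + S * w) *ℚ s) *ℚ ℕ→ℚ (Z * (H + Z))
large-modulus-ℚ {E} {Z} {H} {d} {w} {T} {S} {s} 1≤s E≤ T≤ = begin
  ℕ→ℚ E                                                 ≤⟨ ℕ→ℚ-mono E≤′ ⟩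
  ℕ→ℚ ((d + T * w) * (Z * (H + Z)))                     ≡⟨ ℕ→ℚ-* (d + T * w) (Z * (H + Z)) ⟩
  ℕ→ℚ (d + T * w) *ℚ ℕ→ℚ (Z * (H + Z))                  ≤⟨ *ℚ-mono-≤ (0≤ℕ→ℚ (d + T * w)) (0≤ℕ→ℚ (Z * (H + Z))) factor ℚ.≤-refl ⟩
  (ℕ→ℚ (d + S * w) *ℚ s) *ℚ ℕ→ℚ (Z * (H + Z))           ∎
  where
  open ℚ.≤-Reasoning
  0≤s : 0ℚ ≤ℚ s
  0≤s = ℚ.≤-trans 0≤1ℚ 1≤s
  -- The added cross terms Z² d and Z H u, with u = T w, complete the bound to the product (d + u) Z
  -- (H + Z).
  E≤′ : E ≤ (d + T * w) * (Z * (H + Z))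
  E≤′ = ≤-trans E≤ (≤-trans (m≤m+n _ (Z * Z * d + Z * (H * (T * w)))) (≤-reflexive (expand Z H d (T * w))))
    where
    expand : ∀ Z H d u → Z * (H * d + Z * u) + (Z * Z * d + Z * (H * u)) ≡ (d + u) * (Z * (H + Z))
    expand = ℕ-Solver.solve-∀
  factor : ℕ→ℚ (d + T * w) ≤ℚ ℕ→ℚ (d + S * w) *ℚ s
  factor = begin
    ℕ→ℚ (d + T * w)                                     ≡⟨ trans (ℕ→ℚ-+ d (T * w)) (cong (ℕ→ℚ d +ℚ_) (ℕ→ℚ-* T w)) ⟩
    ℕ→ℚ d +ℚ ℕ→ℚ T *ℚ ℕ→ℚ w                             ≤⟨ ℚ.+-mono-≤ d≤ Tw≤ ⟩
    ℕ→ℚ d *ℚ s +ℚ ℕ→ℚ S *ℚ ℕ→ℚ w *ℚ s                   ≡⟨ ℚ.*-distribʳ-+ s (ℕ→ℚ d) (ℕ→ℚ S *ℚ ℕ→ℚ w) ⟨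
    (ℕ→ℚ d +ℚ ℕ→ℚ S *ℚ ℕ→ℚ w) *ℚ s                      ≡⟨ cong (_*ℚ s) (trans (ℕ→ℚ-+ d (S * w)) (cong (ℕ→ℚ d +ℚ_) (ℕ→ℚ-* S w))) ⟨
    ℕ→ℚ (d + S * w) *ℚ s                                ∎
    where
    d≤ : ℕ→ℚ d ≤ℚ ℕ→ℚ d *ℚ s
    d≤ = ℚ.≤-trans (ℚ.≤-reflexive (sym (ℚ.*-identityʳ (ℕ→ℚ d)))) (*ℚ-mono-≤ (0≤ℕ→ℚ d) 0≤s ℚ.≤-refl 1≤s)
    Tw≤ : ℕ→ℚ T *ℚ ℕ→ℚ w ≤ℚ ℕ→ℚ S *ℚ ℕ→ℚ w *ℚ s
    Tw≤ = ℚ.≤-trans (*ℚ-mono-≤ (0≤ℕ→ℚ T) (0≤ℕ→ℚ w) T≤ ℚ.≤-refl)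
            (ℚ.≤-reflexive (trans (ℚ.*-assoc (ℕ→ℚ S) s (ℕ→ℚ w)) (trans (cong (ℕ→ℚ S *ℚ_) (ℚ.*-comm s (ℕ→ℚ w))) (sym (ℚ.*-assoc (ℕ→ℚ S) (ℕ→ℚ w) s)))))

-- Multiplying by H gives E H ≤ H² Z², and (H² Z²)^D ≤ t^D m² ≤ (t W H)^D since m² ≤ W H^D ≤ (W
-- H)^D. Cancelling the power D and then H leaves W t.
small-modulus-ℚ : ∀ {E Z H m W D t} → .{{NonZero D}} → .{{NonZero W}} → 1 ≤ H → 0ℚ ≤ℚ t → E ≤ Z * (Z * H) → m * m ≤ W * H ^ D →
  ℕ→ℚ ((H * H * Z * Z) ^ D) ≤ℚ (t ^ℚ D) *ℚ ℕ→ℚ (m * m) → ℕ→ℚ E ≤ℚ ℕ→ℚ W *ℚ t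
small-modulus-ℚ {E} {Z} {H} {m} {W} {D} {t} H≥1 0≤t E≤ m²≤ t-hyp =
  ℚ.*-cancelʳ-≤-pos (ℕ→ℚ H) {{positive (ℚ.<-≤-trans (ℚ.positive⁻¹ 1ℚ) (ℕ→ℚ-mono {1} {H} H≥1))}} (begin
    ℕ→ℚ E *ℚ ℕ→ℚ H                    ≡⟨ ℕ→ℚ-* E H ⟨
    ℕ→ℚ (E * H)                       ≤⟨ ℕ→ℚ-mono (≤-trans (*-monoˡ-≤ H E≤) (≤-reflexive (regroup Z H))) ⟩
    ℕ→ℚ (H * H * Z * Z)               ≤⟨ ^ℚ-cancel-≤ (0≤*ℚ 0≤t (0≤ℕ→ℚ (W * H))) D powered ⟩
    t *ℚ ℕ→ℚ (W * H)                  ≡⟨ cong (t *ℚ_) (ℕ→ℚ-* W H) ⟩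
    t *ℚ (ℕ→ℚ W *ℚ ℕ→ℚ H)             ≡⟨ trans (sym (ℚ.*-assoc t (ℕ→ℚ W) (ℕ→ℚ H))) (cong (_*ℚ ℕ→ℚ H) (ℚ.*-comm t (ℕ→ℚ W))) ⟩
    ℕ→ℚ W *ℚ t *ℚ ℕ→ℚ H               ∎)
  where
  open ℚ.≤-Reasoning
  regroup : ∀ Z H → Z * (Z * H) * H ≡ H * H * Z * Z
  regroup = ℕ-Solver.solve-∀
  m²≤′ : m * m ≤ (W * H) ^ D
  m²≤′ = ≤-trans m²≤ (≤-trans
    (*-monoˡ-≤ (H ^ D) (≤-trans (≤-reflexive (sym (^-identityʳ W))) (^-monoʳ-≤ W (>-nonZero⁻¹ D))))
    (≤-reflexive (sym (^-distribʳ-* D W H))))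
  powered : ℕ→ℚ (H * H * Z * Z) ^ℚ D ≤ℚ (t *ℚ ℕ→ℚ (W * H)) ^ℚ D
  powered = begin
    ℕ→ℚ (H * H * Z * Z) ^ℚ D          ≡⟨ ℕ→ℚ-^ (H * H * Z * Z) D ⟨
    ℕ→ℚ ((H * H * Z * Z) ^ D)         ≤⟨ t-hyp ⟩
    (t ^ℚ D) *ℚ ℕ→ℚ (m * m)           ≤⟨ *ℚ-mono-≤ (^ℚ-nonNeg 0≤t D) (0≤ℕ→ℚ ((W * H) ^ D)) ℚ.≤-refl (ℕ→ℚ-mono m²≤′) ⟩
    (t ^ℚ D) *ℚ ℕ→ℚ ((W * H) ^ D)     ≡⟨ cong ((t ^ℚ D) *ℚ_) (ℕ→ℚ-^ (W * H) D) ⟩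
    (t ^ℚ D) *ℚ (ℕ→ℚ (W * H) ^ℚ D)    ≡⟨ ^ℚ-distribʳ-* D t (ℕ→ℚ (W * H)) ⟨
    (t *ℚ ℕ→ℚ (W * H)) ^ℚ D           ∎

-- The case distinction on m in terms of bare numbers: P is the product of the box counts, D =
-- d(d+1), W = (2d)^(2d) and w = 2(d - 1). The sum of the constants of the two cases serves both,
-- since s ≥ 1 and t ≥ 0.
conclude : ∀ {E Z H m P d w C k K W D t s} → .{{NonZero K}} → .{{NonZero W}} → .{{NonZero D}} →
  1 ≤ H → 0ℚ ≤ℚ t → 0ℚ ≤ℚ s → ℕ→ℚ H ≤ℚ (s ^ℚ suc k) →
  ℕ→ℚ ((H * H * Z * Z) ^ D) ≤ℚ (t ^ℚ D) *ℚ ℕ→ℚ (m * m) → P * P ≡ W * H ^ D →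
  E ≤ Z * (Z * H) → (P < m → ∃[ T ] (T ^ (suc k * K) ≤ C * H ^ K × E ≤ Z * (H * d + Z * (T * w)))) →
  ℕ→ℚ E ≤ℚ ((ℕ→ℚ (W + (d + suc C * w)) *ℚ s) *ℚ (t +ℚ ℕ→ℚ (Z * (H + Z))))
conclude {E} {Z} {H} {m} {P} {d} {w} {C} {k} {K} {W} {D} {t} {s} H≥1 0≤t 0≤s s-hyp t-hyp P² trivial large = by-size (m ≤? P)
  where
  C₁ = d + suc C * w
  X = Z * (H + Z)
  1≤s : 1ℚ ≤ℚ s
  1≤s = 1≤ℚ {H} {k} H≥1 0≤s s-hyp
  by-size : Dec (m ≤ P) → ℕ→ℚ E ≤ℚ ((ℕ→ℚ (W + C₁) *ℚ s) *ℚ (t +ℚ ℕ→ℚ X))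
  by-size (yes m≤P) = ℚ.≤-trans
    (small-modulus-ℚ {E} {Z} {H} {m} {W} {D} {t} H≥1 0≤t trivial (≤-trans (*-mono-≤ m≤P m≤P) (≤-reflexive P²)) t-hyp)
    (*ℚ-mono-≤ (0≤ℕ→ℚ W) (ℚ.+-mono-≤ 0≤t (0≤ℕ→ℚ X))
      (ℚ.≤-trans (ℚ.≤-reflexive (sym (ℚ.*-identityʳ (ℕ→ℚ W)))) (*ℚ-mono-≤ (0≤ℕ→ℚ W) 0≤s (ℕ→ℚ-mono (m≤m+n W C₁)) 1≤s))
      (ℚ.≤-trans (ℚ.≤-reflexive (sym (ℚ.+-identityʳ t))) (ℚ.+-mono-≤ (ℚ.≤-refl {t}) (0≤ℕ→ℚ X))))
  by-size (no m≰P) with large (≰⇒> m≰P)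
  ... | T , T≤ , E≤ = ℚ.≤-trans
    (large-modulus-ℚ {E} {Z} {H} {d} {w} {T} {suc C} {s} 1≤s E≤ (root-bound-ℚ {C} {H} {K} {k} {T} {s} 0≤s s-hyp T≤))
    (*ℚ-mono-≤ (0≤*ℚ (0≤ℕ→ℚ C₁) 0≤s) (ℚ.+-mono-≤ 0≤t (0≤ℕ→ℚ X))
      (ℚ.*-monoʳ-≤-nonNeg s {{nonNegative 0≤s}} (ℕ→ℚ-mono (m≤n+m C₁ W)))
      (ℚ.≤-trans (ℚ.≤-reflexive (sym (ℚ.+-identityˡ (ℕ→ℚ X)))) (ℚ.+-mono-≤ 0≤t (ℚ.≤-refl {ℕ→ℚ X}))))

-- Real powers are represented by the rational numbers above them: `s` stands for H^ε with ε =
-- 1/(k+1), and `t` for H² Z² / m^(2/d(d+1)), compared after raising to the power d(d+1) and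
-- multiplying by m². The constant C is chosen after d and k only.
theorem1p2 : (d : ℕ) → 2 ≤ d → (k : ℕ) →
    ∃[ C ] ((m : ℕ) .{{_ : NonZero m}} → 2 ≤ m →
      (a : Fin (suc d) → ℕ) → gcd (a (fromℕ d)) m ≡ 1 →
      (H : ℕ) → 1 ≤ H → H ≤ m →
      (𝒵 : Subset m) →
      (t s : ℚ) →
      0ℚ ≤ℚ t →
      ℕ→ℚ (((H * H * ∣ 𝒵 ∣ * ∣ 𝒵 ∣) ^ (d * suc d)))
        ≤ℚ ((t ^ℚ (d * suc d)) *ℚ ℕ→ℚ ((m * m))) →
      0ℚ ≤ℚ s →
      ℕ→ℚ (H) ≤ℚ (s ^ℚ suc k) →
      ℕ→ℚ (energy m 𝒵 (imageSet m a H))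
        ≤ℚ ((ℕ→ℚ (C) *ℚ s) *ℚ (t +ℚ ℕ→ℚ ((∣ 𝒵 ∣ * (H + ∣ 𝒵 ∣))))))
theorem1p2 (suc zero) (s≤s ())
theorem1p2 d@(suc (suc e)) 2≤d k =
  let Y , K , K≢0 , lift = lifting-exists (suc e)
      -- With M = (k + 1) K the bound of order H^(K/M) for the number of divisors becomes
      -- H^(1/(k+1)), which `s` dominates.
      C , large = large-modulus-bound e {Y} {K} lift (suc k * K) {{m*n≢0 (suc k) K {{_}} {{K≢0}}}}
  in (d * 2) ^ (d + d) + (d + suc C * (suc e + suc e)) ,
    λ m 2≤m a coprime H H≥1 H≤m 𝒵 t s 0≤t t-hyp 0≤s s-hyp →
      conclude {E = energy m 𝒵 (imageSet m a H)} {∣ 𝒵 ∣} {H} {m} {∏ (boxSize H d)} {d} {suc e + suc e} {C} {k} {K}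
        {(d * 2) ^ (d + d)} {d * suc d} {t} {s} {{K≢0}} {{m^n≢0 (d * 2) (d + d)}}
        H≥1 0≤t 0≤s s-hyp t-hyp (∏-boxSize-square H d) (trivial-bound a H 𝒵)
        (λ P<m → large m a (Coprimality.sym (gcd≡1⇒coprime coprime)) H H≥1 P<m 𝒵)
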